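{- Let $\mathbb F_q$ be a finite field with $q$ elements, let $n\ge 2$, let $a_1,\dots,a_n,b\in\mathbb F_q^*$ and let $k,k_1,\dots,k_n,m_1,\dots,m_n$ be positive integers. Let $N_q$ be the number of solutions $(x_1,\dots,x_n)\in\mathbb F_q^n$ of $$(a_1x_1^{m_1}+\dots+a_nx_n^{m_n})^k=bx_1^{k_1}\cdots x_n^{k_n}.$$ Let $d_j=\gcd(m_j,q-1)$ and $k_0=\gcd(k,k_1,\dots,k_n,q-1)$. Assume that for some $0\le t\le n$, $d_1,\dots,d_t$ are odd, $d_{t+1},\dots,d_n$ are even, and the numbers $d_1,\dots,d_t,d_{t+1}/2,\dots,d_n/2$ are pairwise coprime; and assume that $b$ is not a $k_0$th power in $\mathbb F_q$. Then: if $t=0$ and $n$ is even, $$N_q=q^{n-1}-\frac{(q-1)^n+q-1}{q}-(q-1)\sum_{j=1}^{(n-2)/2}\eta((-1)^j)\sigma_{2j}(\eta(a_1),\dots,\eta(a_n))q^{j-1};$$ if $t=n$, $$N_q=q^{n-1}-\frac{(q-1)^n+(-1)^n(q-1)}{q};$$ otherwise $$N_q=q^{n-1}-\frac{(q-1)^n+(-1)^n(q-1)}{q}-(-1)^n(q-1)\sum_{j=1}^{[(n-t)/2]}\eta((-1)^j)\sigma_{2j}(\eta(a_{t+1}),\dots,\eta(a_n))q^{j-1}.$$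
   Context: For $q$ odd, $\eta$ is the quadratic character of $\mathbb F_q$: $\eta(x)=1,-1,0$ according as $x$ is a nonzero square, a nonsquare, or $0$ (in the cases where $\eta$ appears, some $d_j$ is even, so $q$ is odd). $\sigma_{2j}(z_1,\dots,z_r)$ denotes the elementary symmetric polynomial of degree $2j$ in $z_1,\dots,z_r$. $[x]$ denotes the integer part; empty sums are $0$. -}

module Defs where

open import Algebra.Bundles using (CommutativeRing; CommutativeSemiring)
import Algebra.Definitions.RawSemiring as RawSemiringDefs
open import Data.Bool.Base using (if_then_else_)
open import Data.Fin.Base using (Fin)
open import Data.Fin.Properties as Fin using (any?; nonZeroIndex)
open import Data.Integer.Base as ℤ using (ℤ; 0ℤ; 1ℤ; -1ℤ)
open import Data.List.Base using (List; []; _∷_; [_]; _++_; map; foldr; filter; length; upTo; allFin; cartesianProductWith)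
open import Data.Nat.Base using (ℕ; zero; suc; NonZero)
open import Data.Product.Base using (∃; _,_)
open import Data.Rational.Base as ℚ using (ℚ)
open import Data.Vec.Functional as Vector using (Vector)
open import Function.Bundles using (Inverse)
open import Function.Properties.Inverse using (Inverse⇒Injection)
open import Level using (_⊔_) renaming (suc to lsuc)
open import Relation.Binary.Definitions using (Decidable)
import Relation.Binary.PropositionalEquality as ≡
open import Relation.Nullary.Decidable using (does; map′; via-injection)
import Relation.Unary as U

sumℤ productℤ : List ℤ → ℤ
sumℤ     = foldr ℤ._+_ 0ℤ
productℤ = foldr ℤ._*_ 1ℤ

-- ∑₁ M f = f 1 + f 2 + ... + f M
∑₁ : ℕ → (ℕ → ℤ) → ℤ
∑₁ M f = sumℤ (map (λ i → f (suc i)) (upTo M))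

-- All ways of choosing k entries of a list, by position and in order.
choose : ∀ {a} {A : Set a} → ℕ → List A → List (List A)
choose zero    _        = [ [] ]
choose (suc k) []       = []
choose (suc k) (z ∷ zs) = map (z ∷_) (choose k zs) ++ choose (suc k) zs

-- The value of the elementary symmetric polynomial of degree k.
σ : ℕ → List ℤ → ℤ
σ k zs = sumℤ (map productℤ (choose k zs))

fromℤ : ℤ → ℚ
fromℤ z = z ℚ./ 1

record FiniteField c ℓ (q : ℕ) : Set (lsuc (c ⊔ ℓ)) where
  field
    commutativeRing : CommutativeRing c ℓ

  open CommutativeRing commutativeRing public

  field
    0≉1         : 0# ≉ 1#
    inverse     : ∀ x → x ≉ 0# → ∃ λ y → x * y ≈ 1#
    enumeration : Inverse setoid (≡.setoid (Fin q))

  open RawSemiringDefs (CommutativeSemiring.rawSemiring commutativeSemiring) public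
    using (_^_; sum; product)

  open Inverse enumeration using (to; from; strictlyInverseʳ)

  q-nonZero : NonZero q
  q-nonZero = nonZeroIndex (to 0#)

  _/q : ℤ → ℚ
  z /q = ℚ._/_ z q {{q-nonZero}}

  infix 4 _≟_
  _≟_ : Decidable _≈_
  _≟_ = via-injection (Inverse⇒Injection enumeration) Fin._≟_

  IsPower : ℕ → Carrier → Set (c ⊔ ℓ)
  IsPower k x = ∃ λ y → y ^ k ≈ x

  isSquare? : U.Decidable (IsPower 2)
  isSquare? x = map′
    (λ (i , p) → from i , p)
    (λ (y , p) → to y , trans (*-cong (strictlyInverseʳ y) (*-congʳ (strictlyInverseʳ y))) p)
    (any? λ i → from i ^ 2 ≟ x)

  η : Carrier → ℤ
  η x = if does (x ≟ 0#) then 0ℤ else if does (isSquare? x) then 1ℤ else -1ℤ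

  -- One representative of each ≈-class, without repetition.
  elements : List Carrier
  elements = map from (allFin q)

  tuples : ∀ n → List (Vector Carrier n)
  tuples zero    = [ Vector.[] ]
  tuples (suc n) = cartesianProductWith Vector._∷_ elements (tuples n)

  count : ∀ {p n} {P : Vector Carrier n → Set p} → U.Decidable P → ℕ
  count {n = n} P? = length (filter P? (tuples n))

{-# OPTIONS --safe #-}

-- As b is not a k₀th power, a solution has a zero coordinate, hence also a zero sum; so N is the number of zeros of
-- Σ aⱼ xⱼ^mⱼ in F_q^n minus the number of those without zero coordinates.
--
-- In either count mⱼ may be replaced by gcd(mⱼ, L) whenever the number of ways to choose the other coordinates is
-- invariant under multiplication by Lth powers: by Euclid's algorithm on the exponents,
--   Σ_{x,y≠0} f(x^m y^L) = (q - 1) Σ_{x≠0} f(x^gcd(m,L)).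
-- Coprimality then reduces every exponent to 1 (j ≤ t) or 2 (j > t).
--
-- Summing over x with u replaced by a x + u or a x² + u preserves the span of 1, E = q δ₀ - 1 and η, because
--   Σ_x η(a x² + u) = η(a) E(u)   and   Σ_x E(a x² + u) = η(a) η(-1) q η(u).
-- Starting from q δ₀ = 1 + E and summing over one coordinate after the other gives a recursion for the coefficients
-- of E and η, solved by the elementary symmetric polynomials of even and odd degree in the η(aⱼ).
module Submission where

open import Defs
open import Algebra.Bundles using (CommutativeMonoid; CommutativeSemiring)
import Algebra.Properties.CommutativeMonoid.Sum as MonoidSum
import Algebra.Properties.CommutativeSemiring.Exp as Exp
import Algebra.Properties.Ring as RingProperties
import Algebra.Properties.Semiring.Sum as SemiringSum
open import Data.Bool.Base using (true; false; if_then_else_; T)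
open import Data.Fin.Base as Fin using (Fin; zero; suc; toℕ)
open import Data.Fin.Permutation using (Permutation′; permutation)
import Data.Fin.Properties as Fin
open import Data.Integer.Base as ℤ using (ℤ; +_; 0ℤ; 1ℤ; -1ℤ)
import Data.Integer.Properties as ℤ
open import Data.Integer.Tactic.RingSolver using (solve-∀)
open import Data.List.Base as List using (List; []; _∷_; _++_; map; length; filter; applyUpTo; cartesianProductWith; drop; tabulate)
import Data.List.Properties as List
open import Data.Nat.Base as ℕ using (ℕ; zero; suc; _≤_; _<_; _∸_; _<ᵇ_; _/_; _%_; z≤n; s≤s; NonZero)
open import Data.Nat.Coprimality using (Coprime; coprime-divisor; coprime-factors)
open import Data.Nat.Divisibility
open import Data.Nat.DivMod using (m/n*n≡m; m≡m%n+[m/n]*n; m%n<n)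
open import Data.Nat.GCD
import Data.Nat.Properties as ℕ
open import Data.Product.Base using (∃; _×_; _,_; proj₁; proj₂)
open import Data.Rational.Base as ℚ using (ℚ)
import Data.Rational.Properties as ℚ
open import Data.Rational.Unnormalised.Base as ℚᵘ using (mkℚᵘ; *≡*)
import Data.Rational.Unnormalised.Properties as ℚᵘ
open import Data.Sum.Base using (_⊎_; inj₁; inj₂)
open import Data.Unit.Base using (⊤; tt)
open import Data.Vec.Functional as Vector using (Vector; head; tail)
open import Function.Base using (_∘_; case_of_)
open import Function.Bundles using (Inverse; Injection)
open import Function.Properties.Inverse using (Inverse⇒Injection)
import Level
open import Relation.Binary.PropositionalEquality as ≡ using (_≡_; _≢_; _≗_; cong; cong₂)
import Relation.Binary.Reasoning.Setoid as SetoidReasoning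
open import Relation.Nullary.Decidable using (Dec; yes; no; does; dec-true; dec-false)
open import Relation.Nullary.Negation using (¬_; contradiction)
import Relation.Unary as U

-- The two counts differ only in the weight z of a zero coordinate, 1 or 0. Keeping z as a parameter
-- lets one argument serve both; in the recursion it survives as y = z - 1. The exponents are
-- reduced in two passes. By Fermat every function is invariant under (q - 1)th powers, which
-- replaces mⱼ by dⱼ, the numbers to which coprimality refers. In the second pass L must suit all
-- other coordinates at once. Treating the coordinates in order, those already done have exponent 1
-- or 2 and those to come still have dⱼ, so twice the product of the later `d′` is a possible L, and
-- coprimality gives gcd(dⱼ, L) = gcd(dⱼ, 2). The classical tool for such counts, Gauss sums, would
-- require roots of unity. Here the integer-valued functions E and η replace the additive
-- characters. All identities are proved in ℤ after multiplication by q, and division by q comes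
-- only at the very end.

0<gcd : ∀ {m n} → 0 < m → 0 < gcd m n
0<gcd {m} {n} 0<m = ℕ.n≢0⇒n>0 (gcd[m,n]≢0 m n (inj₁ (ℕ.m<n⇒n≢0 0<m)))

gcd-∸ : ∀ {m n} → m ≤ n → gcd m (n ∸ m) ≡ gcd m n
gcd-∸ {m} {n} m≤n = GCD.unique (≡.subst (λ k → GCD m k (gcd m (n ∸ m))) (ℕ.m+[n∸m]≡n m≤n) (GCD.step (gcd-GCD m (n ∸ m)))) (gcd-GCD m n)

-- Sums over the field in a commutative monoid: integers, the field under multiplication, the field
-- under addition.

module FiniteFieldSums {c ℓ q} (F : FiniteField c ℓ q) {a ℓ′} (M : CommutativeMonoid a ℓ′) where
  open FiniteField F using (Carrier; _≈_; _≉_; _≟_; enumeration)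
  private module F = FiniteField F
  open Inverse enumeration using (to; from; to-cong; strictlyInverseˡ; strictlyInverseʳ)
  open CommutativeMonoid M using (ε; _∙_; ∙-cong; identityˡ; identityʳ; setoid)
    renaming (Carrier to A; _≈_ to _≈ᴹ_; refl to reflᴹ; sym to symᴹ; trans to transᴹ)
  open MonoidSum M
  open SetoidReasoning setoid

  private
    sum-ε : ∀ {n} (f : Vector A n) → (∀ i → f i ≈ᴹ ε) → sum f ≈ᴹ ε
    sum-ε {n} f f≈ε = transᴹ (sum-cong-≋ f≈ε) (sum-replicate-zero n)

    sum-support : ∀ {n} (f : Vector A n) j → (∀ i → i ≢ j → f i ≈ᴹ ε) → sum f ≈ᴹ f j
    sum-support f zero f≈ε =
      transᴹ (∙-cong reflᴹ (sum-ε (f ∘ suc) (λ i → f≈ε (suc i) (λ ())))) (identityʳ _)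
    sum-support f (suc j) f≈ε =
      transᴹ (∙-cong (f≈ε zero (λ ())) (sum-support (f ∘ suc) j (λ i i≢j → f≈ε (suc i) (i≢j ∘ Fin.suc-injective))))
             (identityˡ _)

  -- Opaque, so that unification recovers f from ⨁ f.
  opaque
    ⨁ : (Carrier → A) → A
    ⨁ f = sum (λ i → f (from i))

  Congruent : (Carrier → A) → Set _
  Congruent f = ∀ {x y} → x ≈ y → f x ≈ᴹ f y

  opaque
    unfolding ⨁

    ⨁-cong : ∀ {f g} → (∀ x → f x ≈ᴹ g x) → ⨁ f ≈ᴹ ⨁ g
    ⨁-cong f≈g = sum-cong-≋ (λ i → f≈g (from i))

    ⨁-distrib : ∀ f g → ⨁ (λ x → f x ∙ g x) ≈ᴹ ⨁ f ∙ ⨁ g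
    ⨁-distrib f g = ∑-distrib-+ (f ∘ from) (g ∘ from)

    ⨁-swap : ∀ (f : Carrier → Carrier → A) →
             ⨁ (λ x → ⨁ (λ y → f x y)) ≈ᴹ ⨁ (λ y → ⨁ (λ x → f x y))
    ⨁-swap f = ∑-comm (λ i j → f (from i) (from j))

    -- Conjugation by the enumeration turns π into a permutation of `Fin q`. Congruence of f is
    -- needed since `from` after `to` returns only an equivalent element.
    ⨁-reindex : ∀ {f} → Congruent f → (π π⁻¹ : Carrier → Carrier) →
                (∀ {x y} → x ≈ y → π x ≈ π y) → (∀ {x y} → x ≈ y → π⁻¹ x ≈ π⁻¹ y) →
                (∀ x → π (π⁻¹ x) ≈ x) → (∀ x → π⁻¹ (π x) ≈ x) →
                ⨁ (λ x → f (π x)) ≈ᴹ ⨁ f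
    ⨁-reindex {f} f-cong π π⁻¹ π-cong π⁻¹-cong ππ⁻¹ π⁻¹π = begin
      ⨁ (λ x → f (π x))                        ≈⟨ ⨁-cong (λ x → f-cong (strictlyInverseʳ (π x))) ⟨
      sum (λ i → f (from (to (π (from i)))))   ≈⟨ sum-permute (f ∘ from) ρ ⟨
      ⨁ f                                      ∎
      where
      conj : ∀ (φ ψ : Carrier → Carrier) → (∀ {x y} → x ≈ y → φ x ≈ φ y) → (∀ x → φ (ψ x) ≈ x) →
             ∀ i → to (φ (from (to (ψ (from i))))) ≡ i
      conj φ ψ φ-cong φψ i = ≡.trans
        (to-cong (F.trans (φ-cong (strictlyInverseʳ (ψ (from i)))) (φψ (from i))))
        (strictlyInverseˡ i)
      ρ : Permutation′ q
      ρ = permutation (to ∘ π ∘ from) (to ∘ π⁻¹ ∘ from)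
            (conj π π⁻¹ π-cong ππ⁻¹) (conj π⁻¹ π π⁻¹-cong π⁻¹π)

    ⨁-support : ∀ {f} → Congruent f → ∀ y → (∀ x → x ≉ y → f x ≈ᴹ ε) → ⨁ f ≈ᴹ f y
    ⨁-support {f} f-cong y f≈ε = transᴹ
      (sum-support (f ∘ from) (to y)
        (λ i i≢ → f≈ε (from i) (λ p → i≢ (≡.trans (≡.sym (strictlyInverseˡ i)) (to-cong p)))))
      (f-cong (strictlyInverseʳ y))

-- Weighted integer sums over the field and Euclid's algorithm on exponents.

module PowerSums {c ℓ q} (F : FiniteField c ℓ q) where
  open FiniteField F hiding (zero)
  open Inverse enumeration using (from)
  open Exp commutativeSemiring using (^-congˡ; ^-congʳ; ^-homo-*; ^-distrib-*)
  open RingProperties ring using (\\-leftDividesˡ; \\-leftDividesʳ)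
  module ≈ = SetoidReasoning setoid

  1≉0 : 1# ≉ 0#
  1≉0 p = 0≉1 (sym p)

  *-invertˡ : ∀ {c c′} → c * c′ ≈ 1# → ∀ x → c * (c′ * x) ≈ x
  *-invertˡ cc′≈1 x = trans (sym (*-assoc _ _ _)) (trans (*-congʳ cc′≈1) (*-identityˡ x))

  *-invertʳ : ∀ {c c′} → c * c′ ≈ 1# → ∀ x → c′ * (c * x) ≈ x
  *-invertʳ cc′≈1 = *-invertˡ (trans (*-comm _ _) cc′≈1)

  *-cancelˡ : ∀ {c x y} → c ≉ 0# → c * x ≈ c * y → x ≈ y
  *-cancelˡ {c} {x} {y} c≉0 cx≈cy with c′ , cc′≈1 ← inverse c c≉0 =
    trans (sym (*-invertʳ cc′≈1 x)) (trans (*-congˡ cx≈cy) (*-invertʳ cc′≈1 y))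

  xy≈0 : ∀ {x y} → x * y ≈ 0# → x ≉ 0# → y ≈ 0#
  xy≈0 xy≈0 x≉0 = *-cancelˡ x≉0 (trans xy≈0 (sym (zeroʳ _)))

  *-nonzero : ∀ {x y} → x ≉ 0# → y ≉ 0# → x * y ≉ 0#
  *-nonzero x≉0 y≉0 p = y≉0 (xy≈0 p x≉0)

  ^-nonzero : ∀ {x} n → x ≉ 0# → x ^ n ≉ 0#
  ^-nonzero zero    x≉0 = 1≉0
  ^-nonzero (suc n) x≉0 = *-nonzero x≉0 (^-nonzero n x≉0)

  0^n≈0 : ∀ {x} n → 0 < n → x ≈ 0# → x ^ n ≈ 0#
  0^n≈0 (suc n) _ x≈0 = trans (*-congʳ x≈0) (zeroˡ _)

  open FiniteFieldSums F ℤ.+-0-commutativeMonoid public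
    renaming (⨁ to ∑; ⨁-cong to ∑-cong; ⨁-distrib to ∑-distrib; ⨁-swap to ∑-swap; ⨁-reindex to ∑-reindex; ⨁-support to ∑-support)

  module ℤSum = SemiringSum (CommutativeSemiring.semiring ℤ.+-*-commutativeSemiring)

  opaque
    unfolding ∑

    ∑-*ˡ : ∀ c f → ∑ (λ x → c ℤ.* f x) ≡ c ℤ.* ∑ f
    ∑-*ˡ c f = ≡.sym (ℤSum.*-distribˡ-sum c (f ∘ from))

    ∑-1 : ∑ (λ _ → 1ℤ) ≡ + q
    ∑-1 = go q
      where
      go : ∀ n → ℤSum.sum {n} (λ _ → 1ℤ) ≡ + n
      go zero    = ≡.refl
      go (suc n) = cong (λ s → 1ℤ ℤ.+ s) (go n)

  -- I 1ℤ sums over the field, I 0ℤ over its nonzero elements.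
  weight : ℤ → Carrier → ℤ
  weight z x = if does (x ≟ 0#) then z else 1ℤ

  weight-0 : ∀ {z x} → x ≈ 0# → weight z x ≡ z
  weight-0 {z} {x} p = cong (if_then z else 1ℤ) (dec-true (x ≟ 0#) p)

  weight-≉0 : ∀ {z x} → x ≉ 0# → weight z x ≡ 1ℤ
  weight-≉0 {z} {x} p = cong (if_then z else 1ℤ) (dec-false (x ≟ 0#) p)

  weight-cong : ∀ {z} → Congruent (weight z)
  weight-cong {z} {x} {y} p = case x ≟ 0# of λ where
    (yes x≈0) → ≡.trans (weight-0 x≈0) (≡.sym (weight-0 (trans (sym p) x≈0)))
    (no x≉0)  → ≡.trans (weight-≉0 x≉0) (≡.sym (weight-≉0 (λ y≈0 → x≉0 (trans p y≈0))))

  opaque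
    I : ℤ → (Carrier → ℤ) → ℤ
    I z f = ∑ (λ x → weight z x ℤ.* f x)

    I-cong : ∀ {z f g} → f ≗ g → I z f ≡ I z g
    I-cong {z} p = ∑-cong (λ x → cong (weight z x ℤ.*_) (p x))

    I-cong* : ∀ {f g} → (∀ x → x ≉ 0# → f x ≡ g x) → I 0ℤ f ≡ I 0ℤ g
    I-cong* {f} {g} p = ∑-cong λ x → aux x
      where
      aux : ∀ x → weight 0ℤ x ℤ.* f x ≡ weight 0ℤ x ℤ.* g x
      aux x = case x ≟ 0# of λ where
        (yes x≈0) → ≡.trans (cong (ℤ._* f x) (weight-0 x≈0)) (≡.sym (cong (ℤ._* g x) (weight-0 x≈0)))
        (no x≉0)  → cong (weight 0ℤ x ℤ.*_) (p x x≉0)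

  opaque
    unfolding I

    I-*ˡ : ∀ {z} c f → I z (λ x → c ℤ.* f x) ≡ c ℤ.* I z f
    I-*ˡ {z} c f = ≡.trans (∑-cong (λ x → lem (weight z x) c (f x))) (∑-*ˡ c _)
      where
      lem : ∀ w c f → w ℤ.* (c ℤ.* f) ≡ c ℤ.* (w ℤ.* f)
      lem = solve-∀

    I-+ : ∀ {z} f g → I z (λ x → f x ℤ.+ g x) ≡ I z f ℤ.+ I z g
    I-+ {z} f g = ≡.trans (∑-cong (λ x → ℤ.*-distribˡ-+ (weight z x) (f x) (g x))) (∑-distrib _ _)

    I-swap : ∀ {z z′} (f : Carrier → Carrier → ℤ) →
             I z (λ x → I z′ (f x)) ≡ I z′ (λ y → I z (λ x → f x y))
    I-swap {z} {z′} f = begin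
      ∑ (λ x → w x ℤ.* ∑ (λ y → v y ℤ.* f x y))   ≡⟨ ∑-cong (λ x → ∑-*ˡ (w x) _) ⟨
      ∑ (λ x → ∑ (λ y → w x ℤ.* (v y ℤ.* f x y))) ≡⟨ ∑-swap _ ⟩
      ∑ (λ y → ∑ (λ x → w x ℤ.* (v y ℤ.* f x y))) ≡⟨ ∑-cong (λ y → ∑-cong λ x → lem (w x) (v y) (f x y)) ⟩
      ∑ (λ y → ∑ (λ x → v y ℤ.* (w x ℤ.* f x y))) ≡⟨ ∑-cong (λ y → ∑-*ˡ (v y) _) ⟩
      ∑ (λ y → v y ℤ.* ∑ (λ x → w x ℤ.* f x y))   ∎
      where
      open ≡.≡-Reasoning
      w v : Carrier → ℤ
      w = weight z
      v = weight z′
      lem : ∀ w v f → w ℤ.* (v ℤ.* f) ≡ v ℤ.* (w ℤ.* f)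
      lem = solve-∀

  ∑-scale : ∀ {f} → Congruent f → ∀ {c} → c ≉ 0# → ∑ (λ x → f (c * x)) ≡ ∑ f
  ∑-scale f-cong {c} c≉0 with c′ , cc′≈1 ← inverse c c≉0 =
    ∑-reindex f-cong (c *_) (c′ *_) *-congˡ *-congˡ (*-invertˡ cc′≈1) (*-invertʳ cc′≈1)

  ∑-translate : ∀ {f} → Congruent f → ∀ c → ∑ (λ x → f (c + x)) ≡ ∑ f
  ∑-translate f-cong c =
    ∑-reindex f-cong (λ x → c + x) (λ x → - c + x) +-congˡ +-congˡ (\\-leftDividesˡ c) (\\-leftDividesʳ c)

  weight-scale : ∀ {z c} → c ≉ 0# → ∀ x → weight z (c * x) ≡ weight z x
  weight-scale {z} {c} c≉0 x = case x ≟ 0# of λ where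
    (yes x≈0) → ≡.trans (weight-0 (trans (*-congˡ x≈0) (zeroʳ c))) (≡.sym (weight-0 x≈0))
    (no x≉0)  → ≡.trans (weight-≉0 (*-nonzero c≉0 x≉0)) (≡.sym (weight-≉0 x≉0))

  opaque
    unfolding I

    I-scale : ∀ {z f} → Congruent f → ∀ {c} → c ≉ 0# → I z (λ x → f (c * x)) ≡ I z f
    I-scale {z} {f} f-cong {c} c≉0 = ≡.trans
      (∑-cong (λ x → cong (ℤ._* f (c * x)) (≡.sym (weight-scale c≉0 x))))
      (∑-scale (λ p → cong₂ ℤ._*_ (weight-cong p) (f-cong p)) c≉0)

    -- The weight differs from 1 only at 0, by z - 1, so one term corrects the full sum. This is the
    -- origin of y = z - 1 in the recursions below.
    I-split : ∀ {z f} → Congruent f → I z f ≡ ∑ f ℤ.+ (z ℤ.- 1ℤ) ℤ.* f 0#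
    I-split {z} {f} f-cong = begin
      I z f                                     ≡⟨ ∑-cong (λ x → lem (weight z x) (f x)) ⟩
      ∑ (λ x → f x ℤ.+ (weight z x ℤ.- 1ℤ) ℤ.* f x) ≡⟨ ∑-distrib _ _ ⟩
      ∑ f ℤ.+ ∑ g                               ≡⟨ cong (λ s → ∑ f ℤ.+ s) (∑-support g-cong 0# g≡0) ⟩
      ∑ f ℤ.+ g 0#                              ≡⟨ cong (λ w → ∑ f ℤ.+ (w ℤ.- 1ℤ) ℤ.* f 0#) (weight-0 refl) ⟩
      ∑ f ℤ.+ (z ℤ.- 1ℤ) ℤ.* f 0#               ∎
      where
      open ≡.≡-Reasoning
      lem : ∀ w f → w ℤ.* f ≡ f ℤ.+ (w ℤ.- 1ℤ) ℤ.* f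
      lem = solve-∀
      g : Carrier → ℤ
      g x = (weight z x ℤ.- 1ℤ) ℤ.* f x
      g-cong : Congruent g
      g-cong p = cong₂ ℤ._*_ (cong (ℤ._- 1ℤ) (weight-cong p)) (f-cong p)
      g≡0 : ∀ x → x ≉ 0# → g x ≡ 0ℤ
      g≡0 x x≉0 = cong (λ w → (w ℤ.- 1ℤ) ℤ.* f x) (weight-≉0 x≉0)

  I-split* : ∀ {z f} → Congruent f → I z f ≡ I 0ℤ f ℤ.+ z ℤ.* f 0#
  I-split* {z} {f} f-cong = begin
    I z f ≡⟨ I-split f-cong ⟩
    ∑ f ℤ.+ (z ℤ.- 1ℤ) ℤ.* f 0# ≡⟨ lem (∑ f) z (f 0#) ⟩
    (∑ f ℤ.+ (0ℤ ℤ.- 1ℤ) ℤ.* f 0#) ℤ.+ z ℤ.* f 0# ≡⟨ cong (ℤ._+ z ℤ.* f 0#) (I-split f-cong) ⟨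
    I 0ℤ f ℤ.+ z ℤ.* f 0# ∎
    where
    open ≡.≡-Reasoning
    lem : ∀ s z f → s ℤ.+ (z ℤ.- 1ℤ) ℤ.* f ≡ (s ℤ.+ (0ℤ ℤ.- 1ℤ) ℤ.* f) ℤ.+ z ℤ.* f
    lem = solve-∀

  q∸1 : ℤ
  q∸1 = + q ℤ.- 1ℤ

  I-const : ∀ c → I 0ℤ (λ _ → c) ≡ q∸1 ℤ.* c
  I-const c = begin
    I 0ℤ (λ _ → c) ≡⟨ I-split {f = λ _ → c} (λ _ → ≡.refl) ⟩
    ∑ (λ _ → c) ℤ.+ (0ℤ ℤ.- 1ℤ) ℤ.* c ≡⟨ cong (ℤ._+ _) (∑-cong (λ x → ℤ.*-identityʳ c)) ⟨
    ∑ (λ _ → c ℤ.* 1ℤ) ℤ.+ (0ℤ ℤ.- 1ℤ) ℤ.* c ≡⟨ cong (ℤ._+ _) (∑-*ˡ c (λ _ → 1ℤ)) ⟩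
    c ℤ.* ∑ (λ _ → 1ℤ) ℤ.+ (0ℤ ℤ.- 1ℤ) ℤ.* c ≡⟨ cong (λ s → c ℤ.* s ℤ.+ (0ℤ ℤ.- 1ℤ) ℤ.* c) ∑-1 ⟩
    c ℤ.* (+ q) ℤ.+ (0ℤ ℤ.- 1ℤ) ℤ.* c ≡⟨ lem c (+ q) ⟩
    q∸1 ℤ.* c ∎
    where
    open ≡.≡-Reasoning
    lem : ∀ c Q → c ℤ.* Q ℤ.+ (0ℤ ℤ.- 1ℤ) ℤ.* c ≡ (Q ℤ.- 1ℤ) ℤ.* c
    lem = solve-∀

  1<q : 1 < q
  1<q = go q enumeration
    where
    go : ∀ n → Inverse setoid (≡.setoid (Fin n)) → 1 < n
    go zero          e with () ← Inverse.to e 0#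
    go (suc zero)    e = contradiction (Injection.injective (Inverse⇒Injection e) (Fin1-≡ (Inverse.to e 0#) (Inverse.to e 1#))) 0≉1
      where
      Fin1-≡ : ∀ (i j : Fin 1) → i ≡ j
      Fin1-≡ Fin.zero Fin.zero = ≡.refl
    go (suc (suc _)) e = s≤s (s≤s z≤n)

  q∸1-+ : q∸1 ≡ + (q ∸ 1)
  q∸1-+ = ≡.trans (ℤ.m-n≡m⊖n q 1) (ℤ.⊖-≥ (ℕ.<⇒≤ 1<q))

  cancel-q∸1 : ∀ {x y} → q∸1 ℤ.* x ≡ q∸1 ℤ.* y → x ≡ y
  cancel-q∸1 {x} {y} = ℤ.*-cancelˡ-≡ q∸1 x y {{nz}}
    where
    nz : ℤ.NonZero q∸1
    nz = ≡.subst ℤ.NonZero (≡.sym q∸1-+) (ℕ.>-nonZero (ℕ.m<n⇒0<n∸m 1<q))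

  -- For fixed y ≠ 0, substituting x for y x absorbs a factor y^m. This is why y must avoid 0.
  euclid-step : ∀ {f} → Congruent f → ∀ m L → m ≤ L →
                I 0ℤ (λ x → I 0ℤ (λ y → f (x ^ m * y ^ L))) ≡
                I 0ℤ (λ x → I 0ℤ (λ y → f (x ^ m * y ^ (L ∸ m))))
  euclid-step {f} f-cong m L m≤L = begin
    I 0ℤ (λ x → I 0ℤ (λ y → f (x ^ m * y ^ L)))                  ≡⟨ I-swap _ ⟩
    I 0ℤ (λ y → I 0ℤ (λ x → f (x ^ m * y ^ L)))                  ≡⟨ I-cong (λ y → I-cong λ x → f-cong (regroup x y)) ⟩
    I 0ℤ (λ y → I 0ℤ (λ x → f ((y * x) ^ m * y ^ (L ∸ m))))      ≡⟨ I-cong* (λ y y≉0 → I-scale (λ p → f-cong (*-congʳ (^-congˡ m p))) y≉0) ⟩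
    I 0ℤ (λ y → I 0ℤ (λ x → f (x ^ m * y ^ (L ∸ m))))            ≡⟨ I-swap _ ⟩
    I 0ℤ (λ x → I 0ℤ (λ y → f (x ^ m * y ^ (L ∸ m))))            ∎
    where
    open ≡.≡-Reasoning
    regroup : ∀ x y → x ^ m * y ^ L ≈ (y * x) ^ m * y ^ (L ∸ m)
    regroup x y = ≈.begin
      x ^ m * y ^ L                    ≈.≈⟨ *-congˡ (^-congʳ y (≡.sym (ℕ.m+[n∸m]≡n m≤L))) ⟩
      x ^ m * y ^ (m ℕ.+ (L ∸ m))      ≈.≈⟨ *-congˡ (^-homo-* y m (L ∸ m)) ⟩
      x ^ m * (y ^ m * y ^ (L ∸ m))    ≈.≈⟨ *-assoc _ _ _ ⟨
      x ^ m * y ^ m * y ^ (L ∸ m)      ≈.≈⟨ *-congʳ (trans (*-comm _ _) (sym (^-distrib-* y x m))) ⟩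
      (y * x) ^ m * y ^ (L ∸ m)        ≈.∎

  euclid-swap : ∀ {f} → Congruent f → ∀ m L →
                I 0ℤ (λ x → I 0ℤ (λ y → f (x ^ m * y ^ L))) ≡
                I 0ℤ (λ x → I 0ℤ (λ y → f (x ^ L * y ^ m)))
  euclid-swap f-cong m L = ≡.trans (I-swap _) (I-cong (λ y → I-cong λ x → f-cong (*-comm _ _)))

  -- N is a bound that makes the recursion structural. A variable whose exponent has reached 0 no
  -- longer matters and contributes the factor q - 1.
  euclid : ∀ {f} → Congruent f → ∀ N m L → m ℕ.+ L ≤ N →
           I 0ℤ (λ x → I 0ℤ (λ y → f (x ^ m * y ^ L))) ≡ q∸1 ℤ.* I 0ℤ (λ x → f (x ^ gcd m L))
  euclid {f} f-cong N zero L _ = begin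
    I 0ℤ (λ x → I 0ℤ (λ y → f (1# * y ^ L))) ≡⟨ I-const _ ⟩
    q∸1 ℤ.* I 0ℤ (λ y → f (1# * y ^ L))      ≡⟨ cong (q∸1 ℤ.*_) (I-cong (λ y → f-cong (trans (*-identityˡ _) (^-congʳ y (≡.sym (gcd-identityˡ L)))))) ⟩
    q∸1 ℤ.* I 0ℤ (λ x → f (x ^ gcd 0 L))     ∎
    where open ≡.≡-Reasoning
  euclid {f} f-cong N (suc m) zero _ = begin
    I 0ℤ (λ x → I 0ℤ (λ y → f (x ^ suc m * 1#))) ≡⟨ I-swap _ ⟩
    I 0ℤ (λ y → I 0ℤ (λ x → f (x ^ suc m * 1#))) ≡⟨ I-const _ ⟩
    q∸1 ℤ.* I 0ℤ (λ x → f (x ^ suc m * 1#))      ≡⟨ cong (q∸1 ℤ.*_) (I-cong (λ x → f-cong (*-identityʳ _))) ⟩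
    q∸1 ℤ.* I 0ℤ (λ x → f (x ^ suc m))           ∎
    where open ≡.≡-Reasoning
  euclid {f} f-cong (suc N) m@(suc m′) L@(suc L′) (s≤s m+L≤N) with ℕ.≤-total m L
  ... | inj₁ m≤L = begin
    I 0ℤ (λ x → I 0ℤ (λ y → f (x ^ m * y ^ L)))         ≡⟨ euclid-step f-cong m L m≤L ⟩
    I 0ℤ (λ x → I 0ℤ (λ y → f (x ^ m * y ^ (L ∸ m))))   ≡⟨ euclid f-cong N m (L ∸ m) bound ⟩
    q∸1 ℤ.* I 0ℤ (λ x → f (x ^ gcd m (L ∸ m)))          ≡⟨ cong (λ g → q∸1 ℤ.* I 0ℤ (λ x → f (x ^ g))) (gcd-∸ m≤L) ⟩
    q∸1 ℤ.* I 0ℤ (λ x → f (x ^ gcd m L))                ∎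
    where
    open ≡.≡-Reasoning
    bound : m ℕ.+ (L ∸ m) ≤ N
    bound = ≡.subst (_≤ N) (≡.sym (ℕ.m+[n∸m]≡n m≤L)) (ℕ.≤-trans (ℕ.m≤n+m L m′) m+L≤N)
  ... | inj₂ L≤m = begin
    I 0ℤ (λ x → I 0ℤ (λ y → f (x ^ m * y ^ L)))         ≡⟨ euclid-swap f-cong m L ⟩
    I 0ℤ (λ x → I 0ℤ (λ y → f (x ^ L * y ^ m)))         ≡⟨ euclid-step f-cong L m L≤m ⟩
    I 0ℤ (λ x → I 0ℤ (λ y → f (x ^ L * y ^ (m ∸ L))))   ≡⟨ euclid f-cong N L (m ∸ L) bound ⟩
    q∸1 ℤ.* I 0ℤ (λ x → f (x ^ gcd L (m ∸ L)))          ≡⟨ cong (λ g → q∸1 ℤ.* I 0ℤ (λ x → f (x ^ g))) (≡.trans (gcd-∸ L≤m) (gcd-comm L m)) ⟩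
    q∸1 ℤ.* I 0ℤ (λ x → f (x ^ gcd m L))                ∎
    where
    open ≡.≡-Reasoning
    bound : L ℕ.+ (m ∸ L) ≤ N
    bound = ≡.subst (_≤ N) (≡.sym (ℕ.m+[n∸m]≡n L≤m)) (ℕ.≤-trans (ℕ.m≤m+n m L′) (≡.subst (_≤ N) (ℕ.+-suc m′ L′) m+L≤N))

  -- An averaging argument: by invariance a factor y^L can be inserted and summed over all y ≠ 0 at
  -- the cost of a factor q - 1, and `euclid` produces the same factor, which cancels. The values at
  -- 0 are compared separately; they agree because both exponents are positive.
  gcd-reduce : ∀ {z f} → Congruent f → ∀ m L → 0 < m →
               (∀ {v} → v ≉ 0# → ∀ u → f (u * v ^ L) ≡ f u) →
               I z (λ x → f (x ^ m)) ≡ I z (λ x → f (x ^ gcd m L))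
  gcd-reduce {z} {f} f-cong m L 0<m f-inv = begin
    I z (λ x → f (x ^ m)) ≡⟨ I-split* (λ p → f-cong (^-congˡ m p)) ⟩
    I 0ℤ (λ x → f (x ^ m)) ℤ.+ z ℤ.* f (0# ^ m) ≡⟨ cong₂ (λ s t → s ℤ.+ z ℤ.* t) star (f-cong (trans (0^n≈0 m 0<m refl) (sym (0^n≈0 (gcd m L) (0<gcd 0<m) refl)))) ⟩
    I 0ℤ (λ x → f (x ^ gcd m L)) ℤ.+ z ℤ.* f (0# ^ gcd m L) ≡⟨ I-split* (λ p → f-cong (^-congˡ (gcd m L) p)) ⟨
    I z (λ x → f (x ^ gcd m L)) ∎
    where
    open ≡.≡-Reasoning
    star : I 0ℤ (λ x → f (x ^ m)) ≡ I 0ℤ (λ x → f (x ^ gcd m L))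
    star = cancel-q∸1 (begin
      q∸1 ℤ.* I 0ℤ (λ x → f (x ^ m)) ≡⟨ I-const _ ⟨
      I 0ℤ (λ y → I 0ℤ (λ x → f (x ^ m))) ≡⟨ I-cong* (λ y y≉0 → I-cong λ x → ≡.sym (f-inv y≉0 (x ^ m))) ⟩
      I 0ℤ (λ y → I 0ℤ (λ x → f (x ^ m * y ^ L))) ≡⟨ I-swap _ ⟩
      I 0ℤ (λ x → I 0ℤ (λ y → f (x ^ m * y ^ L))) ≡⟨ euclid f-cong _ m L ℕ.≤-refl ⟩
      q∸1 ℤ.* I 0ℤ (λ x → f (x ^ gcd m L)) ∎)

  -- Fermat's little theorem.

  module ∏ = FiniteFieldSums F *-commutativeMonoid

  opaque
    unfolding ∏.⨁

    ∏-const : ∀ c → ∏.⨁ (λ _ → c) ≈ c ^ q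
    ∏-const c = go q
      where
      go : ∀ n → product {n} (λ _ → c) ≈ c ^ n
      go zero    = refl
      go (suc n) = *-congˡ (go n)

    ∏-nonzero : ∀ {f} → (∀ x → f x ≉ 0#) → ∏.⨁ f ≉ 0#
    ∏-nonzero {f} f≉0 = go q (f ∘ from) (λ i → f≉0 (from i))
      where
      go : ∀ n (g : Vector Carrier n) → (∀ i → g i ≉ 0#) → product g ≉ 0#
      go zero    g g≉0 = 1≉0
      go (suc n) g g≉0 = *-nonzero (g≉0 Fin.zero) (go n (g ∘ suc) (g≉0 ∘ suc))

  -- Rescaling the product P of all nonzero x by c. As ∏ runs over 0 as well, `unit` and `extra` correct the factor at 0.
  fermat : ∀ {c} → c ≉ 0# → c ^ (q ∸ 1) ≈ 1#
  fermat {c} c≉0 = *-cancelˡ c≉0 (≈.begin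
      c * c ^ (q ∸ 1)  ≈.≡⟨⟩
      c ^ suc (q ∸ 1)  ≈.≡⟨ cong (c ^_) (ℕ.m+[n∸m]≡n (ℕ.<⇒≤ 1<q)) ⟩
      c ^ q            ≈.≈⟨ *-cancelˡ P≉0 (≈.begin
        P * c ^ q  ≈.≈⟨ *-comm _ _ ⟩
        c ^ q * P  ≈.≈⟨ *-congʳ (∏-const c) ⟨
        ∏.⨁ (λ _ → c) * P ≈.≈⟨ ∏.⨁-distrib _ _ ⟨
        ∏.⨁ (λ x → c * unit x) ≈.≈⟨ ∏.⨁-cong (λ x → sym (rescale x)) ⟩
        ∏.⨁ (λ x → unit (c * x) * extra x) ≈.≈⟨ ∏.⨁-distrib _ _ ⟩
        ∏.⨁ (λ x → unit (c * x)) * ∏.⨁ extra ≈.≈⟨ *-cong scaled (∏.⨁-support extra-cong 0# (λ x x≉0 → extra-≉0 x≉0)) ⟩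
        P * extra 0# ≈.≈⟨ *-congˡ (extra-0 refl) ⟩
        P * c ≈.∎) ⟩
      c                ≈.≈⟨ *-identityʳ c ⟨
      c * 1#           ≈.∎)
    where
    unit extra : Carrier → Carrier
    unit x  = if does (x ≟ 0#) then 1# else x
    extra x = if does (x ≟ 0#) then c else 1#
    P = ∏.⨁ unit
    unit-0 : ∀ {x} → x ≈ 0# → unit x ≈ 1#
    unit-0 {x} p = reflexive (cong (if_then 1# else x) (dec-true (x ≟ 0#) p))
    unit-≉0 : ∀ {x} → x ≉ 0# → unit x ≈ x
    unit-≉0 {x} p = reflexive (cong (if_then 1# else x) (dec-false (x ≟ 0#) p))
    extra-0 : ∀ {x} → x ≈ 0# → extra x ≈ c
    extra-0 {x} p = reflexive (cong (if_then c else 1#) (dec-true (x ≟ 0#) p))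
    extra-≉0 : ∀ {x} → x ≉ 0# → extra x ≈ 1#
    extra-≉0 {x} p = reflexive (cong (if_then c else 1#) (dec-false (x ≟ 0#) p))
    unit-cong : ∏.Congruent unit
    unit-cong {x} {y} p = case x ≟ 0# of λ where
      (yes x≈0) → trans (unit-0 x≈0) (sym (unit-0 (trans (sym p) x≈0)))
      (no x≉0)  → trans (unit-≉0 x≉0) (trans p (sym (unit-≉0 (λ y≈0 → x≉0 (trans p y≈0)))))
    extra-cong : ∏.Congruent extra
    extra-cong {x} {y} p = case x ≟ 0# of λ where
      (yes x≈0) → trans (extra-0 x≈0) (sym (extra-0 (trans (sym p) x≈0)))
      (no x≉0)  → trans (extra-≉0 x≉0) (sym (extra-≉0 (λ y≈0 → x≉0 (trans p y≈0))))
    rescale : ∀ x → unit (c * x) * extra x ≈ c * unit x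
    rescale x = case x ≟ 0# of λ where
      (yes x≈0) → trans (*-cong (unit-0 (trans (*-congˡ x≈0) (zeroʳ c))) (extra-0 x≈0))
                        (trans (*-comm _ _) (*-congˡ (sym (unit-0 x≈0))))
      (no x≉0)  → trans (*-cong (unit-≉0 (*-nonzero c≉0 x≉0)) (extra-≉0 x≉0))
                        (trans (*-identityʳ _) (*-congˡ (sym (unit-≉0 x≉0))))
    scaled : ∏.⨁ (λ x → unit (c * x)) ≈ P
    scaled with c′ , cc′≈1 ← inverse c c≉0 =
      ∏.⨁-reindex unit-cong (c *_) (c′ *_) *-congˡ *-congˡ (*-invertˡ cc′≈1) (*-invertʳ cc′≈1)
    unit-nonzero : ∀ x → unit x ≉ 0#
    unit-nonzero x = case x ≟ 0# of λ where
      (yes x≈0) p → 1≉0 (trans (sym (unit-0 x≈0)) p)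
      (no x≉0)  p → x≉0 (trans (sym (unit-≉0 x≉0)) p)
    P≉0 : P ≉ 0#
    P≉0 = ∏-nonzero unit-nonzero

-- Sums over the later coordinates are invariant under scaling by Mth powers, so that d₀ may be replaced by gcd d₀ M.
Separated : ∀ {n} → Vector ℕ n → Set
Separated {zero}  d = ⊤
Separated {suc n} d = (∃ λ M → 2 ∣ M × (∀ j → tail d j ∣ M) × gcd (head d) M ≡ gcd (head d) 2) × Separated (tail d)

-- Sums over diagonal forms and the reduction of their exponents.

module DiagonalSums {c ℓ q} (F : FiniteField c ℓ q) where
  open FiniteField F hiding (zero)
  open PowerSums F
  open Exp commutativeSemiring using (^-congˡ; ^-distrib-*; ^-assocʳ)

  -- The sum of C(Σ aⱼ xⱼ^eⱼ) over all tuples, each weighted by z to the number of its zero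
  -- coordinates. The partial sums are accumulated in C, so that a coordinate that has been dealt
  -- with simply yields a new C.
  W : ℤ → ∀ {n} → Vector Carrier n → Vector ℕ n → (Carrier → ℤ) → ℤ
  W z {zero}  a e C = C 0#
  W z {suc n} a e C = I z (λ x → W z (tail a) (tail e) (λ u → C (head a * x ^ head e + u)))

  W-cong : ∀ {z n} (a : Vector Carrier n) e {C D} → C ≗ D → W z a e C ≡ W z a e D
  W-cong {n = zero}  a e C≗D = C≗D 0#
  W-cong {n = suc n} a e C≗D = I-cong (λ x → W-cong (tail a) (tail e) (λ u → C≗D (head a * x ^ head e + u)))

  -- Allows one coordinate to be summed innermost and thereby absorbed into C.
  W-swap : ∀ {z z′ n} (a : Vector Carrier n) e (C : Carrier → Carrier → ℤ) →
           I z′ (λ x → W z a e (C x)) ≡ W z a e (λ u → I z′ (λ x → C x u))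
  W-swap {n = zero}  a e C = ≡.refl
  W-swap {n = suc n} a e C = ≡.trans (I-swap _) (I-cong (λ y → W-swap (tail a) (tail e) (λ x u → C x (head a * y ^ head e + u))))

  term-scale : ∀ v a x e k → v ^ (k ℕ.* e) * (a * x ^ e) ≈ a * (v ^ k * x) ^ e
  term-scale v a x e k = ≈.begin
    v ^ (k ℕ.* e) * (a * x ^ e)   ≈.≈⟨ *-congʳ (^-assocʳ v k e) ⟨
    (v ^ k) ^ e * (a * x ^ e)     ≈.≈⟨ *-assoc _ _ _ ⟨
    (v ^ k) ^ e * a * x ^ e       ≈.≈⟨ *-congʳ (*-comm _ a) ⟩
    a * (v ^ k) ^ e * x ^ e       ≈.≈⟨ *-assoc _ _ _ ⟩
    a * ((v ^ k) ^ e * x ^ e)     ≈.≈⟨ *-congˡ (^-distrib-* (v ^ k) x e) ⟨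
    a * (v ^ k * x) ^ e           ≈.∎

  I-scale-term : ∀ {z f} → Congruent f → ∀ a {v} → v ≉ 0# → ∀ {e L} → e ∣ L →
                 I z (λ x → f (v ^ L * (a * x ^ e))) ≡ I z (λ x → f (a * x ^ e))
  I-scale-term {z} {f} f-cong a {v} v≉0 {e} (divides k ≡.refl) = ≡.trans
    (I-cong (λ x → f-cong (term-scale v a x e k)))
    (I-scale (λ p → f-cong (*-congˡ (^-congˡ e p))) (^-nonzero k v≉0))

  -- As each exponent eⱼ divides L, the factor v^L is an eⱼth power and disappears by rescaling xⱼ.
  W-scale : ∀ {z n} (a : Vector Carrier n) e {C} → Congruent C → ∀ {v} → v ≉ 0# → ∀ {L} → (∀ j → e j ∣ L) →
            W z a e (λ u → C (v ^ L * u)) ≡ W z a e C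
  W-scale {n = zero}  a e C-cong v≉0 e∣L = C-cong (zeroʳ _)
  W-scale {z} {n = suc n} a e {C} C-cong {v} v≉0 {L} e∣L = begin
    I z (λ x → W z (tail a) (tail e) (λ u → C (v ^ L * (head a * x ^ head e + u))))
      ≡⟨ I-cong (λ x → W-cong (tail a) (tail e) (λ u → C-cong (distribˡ _ _ _))) ⟩
    I z (λ x → W z (tail a) (tail e) (λ u → C (v ^ L * (head a * x ^ head e) + v ^ L * u)))
      ≡⟨ I-cong (λ x → W-scale (tail a) (tail e) (λ p → C-cong (+-congˡ p)) v≉0 (e∣L ∘ suc)) ⟩
    I z (λ x → W z (tail a) (tail e) (λ u → C (v ^ L * (head a * x ^ head e) + u)))
      ≡⟨ I-scale-term {f = λ w → W z (tail a) (tail e) (λ u → C (w + u))}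
           (λ p → W-cong (tail a) (tail e) (λ u → C-cong (+-congʳ p))) (head a) v≉0 (e∣L zero) ⟩
    I z (λ x → W z (tail a) (tail e) (λ u → C (head a * x ^ head e + u))) ∎
    where open ≡.≡-Reasoning

  Invariant : ℕ → (Carrier → ℤ) → Set _
  Invariant L C = ∀ {v} → v ≉ 0# → ∀ u → C (v ^ L * u) ≡ C u

  Invariant-∣ : ∀ {L M C} → Congruent C → L ∣ M → Invariant L C → Invariant M C
  Invariant-∣ {L} C-cong (divides k ≡.refl) C-inv {v} v≉0 u =
    ≡.trans (C-cong (*-congʳ (sym (^-assocʳ v k L)))) (C-inv (^-nonzero k v≉0) u)

  -- `W-scale` read backwards supplies the factor v^L on u, so that it can be taken out of the whole
  -- argument w + u.
  W-invariant : ∀ {z n} (a : Vector Carrier n) e {C L} → Congruent C → Invariant L C → (∀ j → e j ∣ L) →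
                Invariant L (λ w → W z a e (λ u → C (w + u)))
  W-invariant {z} a e {C} {L} C-cong C-inv e∣L {v} v≉0 w = begin
    W z a e (λ u → C (v ^ L * w + u))         ≡⟨ W-scale a e (λ p → C-cong (+-congˡ p)) v≉0 e∣L ⟨
    W z a e (λ u → C (v ^ L * w + v ^ L * u)) ≡⟨ W-cong a e (λ u → C-cong (sym (distribˡ _ _ _))) ⟩
    W z a e (λ u → C (v ^ L * (w + u)))       ≡⟨ W-cong a e (λ u → C-inv v≉0 (w + u)) ⟩
    W z a e (λ u → C (w + u))                 ∎
    where open ≡.≡-Reasoning

  I-reduce : ∀ {z f} → Congruent f → ∀ a m L → 0 < m → Invariant L f →
             I z (λ x → f (a * x ^ m)) ≡ I z (λ x → f (a * x ^ gcd m L))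
  I-reduce f-cong a m L 0<m f-inv = gcd-reduce {f = λ w → _} (λ p → f-cong (*-congˡ p)) m L 0<m
    (λ v≉0 u → ≡.trans (f-cong (trans (sym (*-assoc _ _ _)) (*-comm _ _))) (f-inv v≉0 (a * u)))

  -- By `fermat`, v^(q - 1) = 1 for v ≠ 0, so invariance is automatic.
  W-reduce-q∸1 : ∀ {z n} (a : Vector Carrier n) m {C} → Congruent C → (∀ j → 0 < m j) →
                 W z a m C ≡ W z a (λ j → gcd (m j) (q ∸ 1)) C
  W-reduce-q∸1 {n = zero}  a m C-cong 0<m = ≡.refl
  W-reduce-q∸1 {z} {n = suc n} a m {C} C-cong 0<m = ≡.trans
    (I-cong (λ x → W-reduce-q∸1 (tail a) (tail m) (λ p → C-cong (+-congˡ p)) (0<m ∘ suc)))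
    (I-reduce f-cong (head a) (head m) (q ∸ 1) (0<m zero)
      (λ v≉0 w → f-cong (trans (*-congʳ (fermat v≉0)) (*-identityˡ w))))
    where
    f : Carrier → ℤ
    f w = W z (tail a) (λ j → gcd (tail m j) (q ∸ 1)) (λ u → C (w + u))
    f-cong : Congruent f
    f-cong p = W-cong (tail a) _ (λ u → C-cong (+-congʳ p))

  -- The later coordinates are invariant under Mth powers since their exponents divide M, and C is
  -- so since 2 divides M; hence the first exponent reduces. It is then 1 or 2, so summing over this
  -- coordinate turns C into a function D again invariant under squares, and the induction continues
  -- with D.
  W-reduce-2 : ∀ {z n} (a : Vector Carrier n) d {C} → Congruent C → (∀ j → 0 < d j) → Invariant 2 C → Separated d →
               W z a d C ≡ W z a (λ j → gcd (d j) 2) C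
  W-reduce-2 {n = zero}  a d C-cong 0<d C-inv _ = ≡.refl
  W-reduce-2 {z} {n = suc n} a d {C} C-cong 0<d C-inv ((M , 2∣M , d∣M , gcd≡) , sep) = begin
    I z (λ x → W′ (tail d) (λ u → C (head a * x ^ head d + u)))
      ≡⟨ I-reduce (λ p → W-cong (tail a) _ (λ u → C-cong (+-congʳ p))) (head a) (head d) M (0<d zero)
           (W-invariant (tail a) (tail d) C-cong (Invariant-∣ C-cong 2∣M C-inv) d∣M) ⟩
    I z (λ x → W′ (tail d) (λ u → C (head a * x ^ gcd (head d) M + u)))
      ≡⟨ cong (λ g → I z (λ x → W′ (tail d) (λ u → C (head a * x ^ g + u)))) gcd≡ ⟩
    I z (λ x → W′ (tail d) (λ u → C (head a * x ^ e + u)))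
      ≡⟨ W-swap (tail a) (tail d) (λ x u → C (head a * x ^ e + u)) ⟩
    W′ (tail d) D
      ≡⟨ W-reduce-2 (tail a) (tail d) (λ p → I-cong (λ x → C-cong (+-congˡ p))) (0<d ∘ suc) D-inv sep ⟩
    W′ (λ j → gcd (tail d j) 2) D
      ≡⟨ W-swap (tail a) _ (λ x u → C (head a * x ^ e + u)) ⟨
    I z (λ x → W′ (λ j → gcd (tail d j) 2) (λ u → C (head a * x ^ e + u))) ∎
    where
    open ≡.≡-Reasoning
    W′ = W z (tail a)
    e = gcd (head d) 2
    D : Carrier → ℤ
    D u = I z (λ x → C (head a * x ^ e + u))
    D-inv : Invariant 2 D
    D-inv {v} v≉0 u = begin
      I z (λ x → C (head a * x ^ e + v ^ 2 * u))
        ≡⟨ I-scale-term (λ p → C-cong (+-congʳ p)) (head a) v≉0 (gcd[m,n]∣n (head d) 2) ⟨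
      I z (λ x → C (v ^ 2 * (head a * x ^ e) + v ^ 2 * u))
        ≡⟨ I-cong (λ x → ≡.trans (C-cong (sym (distribˡ _ _ _))) (C-inv v≉0 _)) ⟩
      I z (λ x → C (head a * x ^ e + u)) ∎

-- The functions δ and E, and the characteristic.

module Delta {c ℓ q} (F : FiniteField c ℓ q) where
  open FiniteField F hiding (zero)
  open PowerSums F
  open RingProperties ring using (x∙y⁻¹≈ε⇒x≈y; x≈y⇒x∙y⁻¹≈ε)

  δ : Carrier → ℤ
  δ u = if does (u ≟ 0#) then 1ℤ else 0ℤ

  δ-0 : ∀ {u} → u ≈ 0# → δ u ≡ 1ℤ
  δ-0 {u} p = cong (if_then 1ℤ else 0ℤ) (dec-true (u ≟ 0#) p)

  δ-≉0 : ∀ {u} → u ≉ 0# → δ u ≡ 0ℤ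
  δ-≉0 {u} p = cong (if_then 1ℤ else 0ℤ) (dec-false (u ≟ 0#) p)

  δ-cong-⇔ : ∀ {u v} → (u ≈ 0# → v ≈ 0#) → (v ≈ 0# → u ≈ 0#) → δ u ≡ δ v
  δ-cong-⇔ {u} u⇒v v⇒u = case u ≟ 0# of λ where
    (yes u≈0) → ≡.trans (δ-0 u≈0) (≡.sym (δ-0 (u⇒v u≈0)))
    (no u≉0)  → ≡.trans (δ-≉0 u≉0) (≡.sym (δ-≉0 (u≉0 ∘ v⇒u)))

  δ-cong : Congruent δ
  δ-cong p = δ-cong-⇔ (trans (sym p)) (trans p)

  ∑-δ : ∀ {C} → Congruent C → ∀ w → ∑ (λ v → δ (w - v) ℤ.* C v) ≡ C w
  ∑-δ {C} C-cong w = ≡.trans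
    (∑-support (λ p → cong₂ ℤ._*_ (δ-cong (+-congˡ (-‿cong p))) (C-cong p)) w
      (λ x x≉w → cong (ℤ._* C x) (δ-≉0 (λ p → x≉w (sym (x∙y⁻¹≈ε⇒x≈y w x p))))))
    (≡.trans (cong (ℤ._* C w) (δ-0 (-‿inverseʳ w))) (ℤ.*-identityˡ _))

  ∑-const : ∀ c → ∑ (λ _ → c) ≡ c ℤ.* (+ q)
  ∑-const c = ≡.trans (∑-cong (λ _ → ≡.sym (ℤ.*-identityʳ c))) (≡.trans (∑-*ˡ c (λ _ → 1ℤ)) (cong (c ℤ.*_) ∑-1))

  ∑δ≡1 : ∑ δ ≡ 1ℤ
  ∑δ≡1 = ≡.trans (∑-support δ-cong 0# (λ _ → δ-≉0)) (δ-0 refl)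

  -- The sum of all nontrivial additive characters at u, in a form that needs no characters.
  E : Carrier → ℤ
  E u = (+ q) ℤ.* δ u ℤ.- 1ℤ

  E-cong : Congruent E
  E-cong p = cong (λ d → (+ q) ℤ.* d ℤ.- 1ℤ) (δ-cong p)

  E-0 : ∀ {u} → u ≈ 0# → E u ≡ q∸1
  E-0 p = ≡.trans (cong (λ d → (+ q) ℤ.* d ℤ.- 1ℤ) (δ-0 p)) (cong (ℤ._- 1ℤ) (ℤ.*-identityʳ (+ q)))

  E-≉0 : ∀ {u} → u ≉ 0# → E u ≡ -1ℤ
  E-≉0 p = ≡.trans (cong (λ d → (+ q) ℤ.* d ℤ.- 1ℤ) (δ-≉0 p)) (cong (ℤ._- 1ℤ) (ℤ.*-zeroʳ (+ q)))

  ∑E≡0 : ∑ E ≡ 0ℤ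
  ∑E≡0 = begin
    ∑ E                                       ≡⟨ ∑-distrib _ _ ⟩
    ∑ (λ u → (+ q) ℤ.* δ u) ℤ.+ ∑ (λ _ → -1ℤ) ≡⟨ cong₂ ℤ._+_ (∑-*ˡ (+ q) δ) (∑-const -1ℤ) ⟩
    (+ q) ℤ.* ∑ δ ℤ.+ -1ℤ ℤ.* (+ q)           ≡⟨ cong (λ s → (+ q) ℤ.* s ℤ.+ -1ℤ ℤ.* (+ q)) ∑δ≡1 ⟩
    (+ q) ℤ.* 1ℤ ℤ.+ -1ℤ ℤ.* (+ q)            ≡⟨ lem (+ q) ⟩
    0ℤ                                        ∎
    where
    open ≡.≡-Reasoning
    lem : ∀ Q → Q ℤ.* 1ℤ ℤ.+ -1ℤ ℤ.* Q ≡ 0ℤ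
    lem = solve-∀

  ∑-affine : ∀ {f} → Congruent f → ∀ {a} → a ≉ 0# → ∀ u → ∑ (λ x → f (a * x + u)) ≡ ∑ f
  ∑-affine {f} f-cong {a} a≉0 u = ≡.trans (∑-scale (λ p → f-cong (+-congʳ p)) a≉0) (∑-translateʳ f-cong u)
    where
    ∑-translateʳ : ∀ {f} → Congruent f → ∀ c → ∑ (λ x → f (x + c)) ≡ ∑ f
    ∑-translateʳ f-cong c = ≡.trans (∑-cong (λ x → f-cong (+-comm x c))) (∑-translate f-cong c)

  module ⊕ = FiniteFieldSums F +-commutativeMonoid

  opaque
    unfolding ⊕.⨁

    -- Translation by 1 permutes the field, so the sum of all elements is unchanged when 1 is added
    -- to each of the q terms.
    q×1≈0 : sum {q} (λ _ → 1#) ≈ 0#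
    q×1≈0 = RingProperties.+-cancelʳ ring total _ _ (begin
      sum {q} (λ _ → 1#) + total     ≈⟨ ⊕.⨁-distrib (λ _ → 1#) (λ x → x) ⟨
      ⊕.⨁ (λ x → 1# + x)         ≈⟨ ⊕.⨁-reindex {f = λ x → x} (λ p → p) (λ x → 1# + x) (λ x → - 1# + x) +-congˡ +-congˡ
                                       (RingProperties.\\-leftDividesˡ ring 1#) (RingProperties.\\-leftDividesʳ ring 1#) ⟩
      total                          ≈⟨ +-identityˡ total ⟨
      0# + total                     ∎)
      where
      open SetoidReasoning setoid
      total : Carrier
      total = ⊕.⨁ (λ x → x)

  -- If 1 + 1 were 0, the q - 1 ones beyond the first would cancel in pairs, and q times 1, which is
  -- 0, would be 1.
  odd⇒1+1≉0 : 2 ∣ q ∸ 1 → 1# + 1# ≉ 0#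
  odd⇒1+1≉0 (divides k q∸1≡k*2) 2≈0 = 0≉1 (≈.begin
    0#                              ≈.≈⟨ q×1≈0 ⟨
    sum {q} (λ _ → 1#)              ≈.≡⟨ cong (λ n → sum {n} (λ _ → 1#)) (ℕ.m+[n∸m]≡n (ℕ.<⇒≤ 1<q)) ⟨
    1# + sum {q ∸ 1} (λ _ → 1#)     ≈.≡⟨ cong (λ n → 1# + sum {n} (λ _ → 1#)) q∸1≡k*2 ⟩
    1# + sum {k ℕ.* 2} (λ _ → 1#)   ≈.≈⟨ +-congˡ (even k) ⟩
    1# + 0#                         ≈.≈⟨ +-identityʳ 1# ⟩
    1#                              ≈.∎)
    where
    even : ∀ k → sum {k ℕ.* 2} (λ _ → 1#) ≈ 0#
    even zero    = refl
    even (suc k) = trans (sym (+-assoc _ _ _)) (trans (+-cong 2≈0 (even k)) (+-identityˡ 0#))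

  opaque
    unfolding ∑

    -- Turns a vanishing sum into a pointwise identity; this is how the multiplicativity of η is
    -- obtained from `∑η≡0`, without a primitive element.
    ∑-nonNegative : ∀ {f : Carrier → ℤ} → (∀ x → 0ℤ ℤ.≤ f x) → ∑ f ≡ 0ℤ → Congruent f → ∀ x → f x ≡ 0ℤ
    ∑-nonNegative {f} 0≤f ∑f≡0 f-cong x = ≡.trans (f-cong (sym (Inverse.strictlyInverseʳ enumeration x)))
      (zeros (λ i → f (from i)) (λ i → 0≤f (from i)) ∑f≡0 (to x))
      where
      open Inverse enumeration using (to; from)
      sum≥0 : ∀ {n} (g : Vector ℤ n) → (∀ i → 0ℤ ℤ.≤ g i) → 0ℤ ℤ.≤ ℤSum.sum g
      sum≥0 {zero}  g 0≤g = ℤ.≤-refl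
      sum≥0 {suc n} g 0≤g = ℤ.+-mono-≤ (0≤g Fin.zero) (sum≥0 (g ∘ suc) (0≤g ∘ suc))
      summands : ∀ {a b} → 0ℤ ℤ.≤ a → 0ℤ ℤ.≤ b → a ℤ.+ b ≡ 0ℤ → a ≡ 0ℤ × b ≡ 0ℤ
      summands {+ 0} {+ b} _ _ p = ≡.refl , p
      summands {ℤ.+[1+ a ]} {+ b} _ _ ()
      zeros : ∀ {n} (g : Vector ℤ n) → (∀ i → 0ℤ ℤ.≤ g i) → ℤSum.sum g ≡ 0ℤ → ∀ i → g i ≡ 0ℤ
      zeros g 0≤g p Fin.zero    = proj₁ (summands (0≤g Fin.zero) (sum≥0 (g ∘ suc) (0≤g ∘ suc)) p)
      zeros g 0≤g p (suc i) = zeros (g ∘ suc) (0≤g ∘ suc) (proj₂ (summands (0≤g Fin.zero) (sum≥0 (g ∘ suc) (0≤g ∘ suc)) p)) i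

-- The quadratic character in odd characteristic.

module QuadraticCharacter {c ℓ q} (F : FiniteField c ℓ q) (1+1≉0 : FiniteField._≉_ F (FiniteField._+_ F (FiniteField.1# F) (FiniteField.1# F)) (FiniteField.0# F)) where
  open FiniteField F hiding (zero)
  open PowerSums F
  open Delta F
  open RingProperties ring using (x∙y⁻¹≈ε⇒x≈y; x≈y⇒x∙y⁻¹≈ε; -‿distribˡ-*; -‿distribʳ-*; -‿involutive; -1*x≈-x)
  open Exp commutativeSemiring using (^-congˡ; ^-distrib-*)

  Square : Carrier → Set _
  Square = IsPower 2

  η-0 : ∀ {x} → x ≈ 0# → η x ≡ 0ℤ
  η-0 {x} p = cong (if_then 0ℤ else if does (isSquare? x) then 1ℤ else -1ℤ) (dec-true (x ≟ 0#) p)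

  η-square : ∀ {x} → x ≉ 0# → Square x → η x ≡ 1ℤ
  η-square {x} x≉0 sq = ≡.trans (cong (if_then 0ℤ else if does (isSquare? x) then 1ℤ else -1ℤ) (dec-false (x ≟ 0#) x≉0))
                                (cong (if_then 1ℤ else -1ℤ) (dec-true (isSquare? x) sq))

  η-nonsquare : ∀ {x} → ¬ Square x → η x ≡ -1ℤ
  η-nonsquare {x} ¬sq = ≡.trans
    (cong (if_then 0ℤ else if does (isSquare? x) then 1ℤ else -1ℤ) (dec-false (x ≟ 0#) (λ x≈0 → ¬sq (0# , trans (zeroˡ _) (sym x≈0)))))
    (cong (if_then 1ℤ else -1ℤ) (dec-false (isSquare? x) ¬sq))

  data Class (x : Carrier) : Set (c Level.⊔ ℓ) where
    isZero      : x ≈ 0# → Class x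
    isSquare    : x ≉ 0# → Square x → Class x
    isNonsquare : x ≉ 0# → ¬ Square x → Class x

  classify : ∀ x → Class x
  classify x = case x ≟ 0# of λ where
    (yes x≈0) → isZero x≈0
    (no x≉0)  → case isSquare? x of λ where
      (yes sq) → isSquare x≉0 sq
      (no ¬sq) → isNonsquare x≉0 ¬sq

  square-resp : ∀ {x y} → x ≈ y → Square x → Square y
  square-resp x≈y (w , w²≈x) = w , trans w²≈x x≈y

  η-cong : Congruent η
  η-cong {x} {y} x≈y = case classify x of λ where
    (isZero x≈0)          → ≡.trans (η-0 x≈0) (≡.sym (η-0 (trans (sym x≈y) x≈0)))
    (isSquare x≉0 sq)     → ≡.trans (η-square x≉0 sq) (≡.sym (η-square (λ y≈0 → x≉0 (trans x≈y y≈0)) (square-resp x≈y sq)))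
    (isNonsquare x≉0 ¬sq) → ≡.trans (η-nonsquare ¬sq) (≡.sym (η-nonsquare (¬sq ∘ square-resp (sym x≈y))))

  square-nonzero : ∀ {w x} → w ^ 2 ≈ x → x ≉ 0# → w ≉ 0#
  square-nonzero w²≈x x≉0 w≈0 = x≉0 (trans (sym w²≈x) (0^n≈0 2 (s≤s z≤n) w≈0))

  square-cancel : ∀ {s v} → s ≉ 0# → Square s → Square (s * v) → Square v
  square-cancel {s} {v} s≉0 (t , t²≈s) (w , w²≈sv) with inverse t (square-nonzero t²≈s s≉0)
  ... | t′ , tt′≈1 = t′ * w , *-cancelˡ s≉0 (≈.begin
      s * (t′ * w) ^ 2          ≈.≈⟨ *-cong (sym t²≈s) (^-distrib-* t′ w 2) ⟩
      t ^ 2 * (t′ ^ 2 * w ^ 2)  ≈.≈⟨ *-assoc _ _ _ ⟨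
      t ^ 2 * t′ ^ 2 * w ^ 2    ≈.≈⟨ *-cong (trans (sym (^-distrib-* t t′ 2)) (trans (^-congˡ 2 tt′≈1) (trans (*-identityˡ _) (*-identityˡ _)))) w²≈sv ⟩
      1# * (s * v)              ≈.≈⟨ *-identityˡ _ ⟩
      s * v                     ≈.∎)

  η-square-* : ∀ {s} → s ≉ 0# → Square s → ∀ v → η (s * v) ≡ η v
  η-square-* {s} s≉0 sq@(t , t²≈s) v = case classify v of λ where
    (isZero v≈0)               → ≡.trans (η-0 (trans (*-congˡ v≈0) (zeroʳ s))) (≡.sym (η-0 v≈0))
    (isSquare v≉0 (w , w²≈v))  → ≡.trans (η-square (*-nonzero s≉0 v≉0) (t * w , trans (^-distrib-* t w 2) (*-cong t²≈s w²≈v)))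
                                         (≡.sym (η-square v≉0 (w , w²≈v)))
    (isNonsquare v≉0 ¬sq)      → ≡.trans (η-nonsquare (¬sq ∘ square-cancel s≉0 sq)) (≡.sym (η-nonsquare ¬sq))

  difference-of-squares : ∀ x w → (x - w) * (x + w) ≈ x ^ 2 - w ^ 2
  difference-of-squares x w = ≈.begin
    (x - w) * (x + w)                      ≈.≈⟨ distribʳ _ _ _ ⟩
    x * (x + w) + - w * (x + w)            ≈.≈⟨ +-cong (distribˡ _ _ _) (distribˡ _ _ _) ⟩
    (x * x + x * w) + (- w * x + - w * w)  ≈.≈⟨ +-assoc _ _ _ ⟩
    x * x + (x * w + (- w * x + - w * w))  ≈.≈⟨ +-congˡ (+-assoc _ _ _) ⟨
    x * x + ((x * w + - w * x) + - w * w)  ≈.≈⟨ +-congˡ (+-congʳ (+-congˡ (trans (sym (-‿distribˡ-* w x)) (-‿cong (*-comm w x))))) ⟩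
    x * x + ((x * w - x * w) + - w * w)    ≈.≈⟨ +-congˡ (+-congʳ (-‿inverseʳ _)) ⟩
    x * x + (0# + - w * w)                 ≈.≈⟨ +-congˡ (+-identityˡ _) ⟩
    x * x + - w * w                        ≈.≈⟨ +-cong (*-congˡ (sym (*-identityʳ x))) (trans (sym (-‿distribˡ-* w w)) (-‿cong (*-congˡ (sym (*-identityʳ w))))) ⟩
    x ^ 2 - w ^ 2                          ≈.∎

  square-roots : ∀ {x w} → x ^ 2 ≈ w ^ 2 → x - w ≈ 0# ⊎ x + w ≈ 0#
  square-roots {x} {w} p = case (x - w) ≟ 0# of λ where
    (yes x-w≈0) → inj₁ x-w≈0
    (no x-w≉0)  → inj₂ (xy≈0 (trans (difference-of-squares x w) (x≈y⇒x∙y⁻¹≈ε p)) x-w≉0)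

  double-nonzero : ∀ {w} → w ≉ 0# → w + w ≉ 0#
  double-nonzero {w} w≉0 w+w≈0 = 1+1≉0 (xy≈0 (trans (distribˡ _ _ _) (trans (+-cong (*-identityʳ w) (*-identityʳ w)) w+w≈0)) w≉0)

  neg-square : ∀ w → (- w) ^ 2 ≈ w ^ 2
  neg-square w = ≈.begin
    - w * (- w * 1#)  ≈.≈⟨ *-congˡ (*-identityʳ _) ⟩
    - w * - w         ≈.≈⟨ -‿distribˡ-* w (- w) ⟨
    - (w * - w)       ≈.≈⟨ -‿cong (-‿distribʳ-* w w) ⟨
    - (- (w * w))     ≈.≈⟨ -‿involutive _ ⟩
    w * w             ≈.≈⟨ *-congˡ (*-identityʳ w) ⟨
    w ^ 2             ≈.∎

  x+w≈0⇒x²≈w² : ∀ {x w} → x + w ≈ 0# → x ^ 2 ≈ w ^ 2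
  x+w≈0⇒x²≈w² {x} {w} p = trans (^-congˡ 2 (x∙y⁻¹≈ε⇒x≈y x (- w) (trans (+-congˡ (-‿involutive w)) p))) (neg-square w)

  -- If v = w² is nonzero, the indicator of x² = v splits into those of x = w and x = -w. These are
  -- different points because 1 + 1 is nonzero.
  #roots : ∀ v → ∑ (λ x → δ (x ^ 2 - v)) ≡ 1ℤ ℤ.+ η v
  #roots v = case classify v of λ where
      (isZero v≈0) → ≡.trans
        (∑-cong (λ x → δ-cong-⇔ (λ p → case x ≟ 0# of λ where
                                  (yes x≈0) → x≈0
                                  (no x≉0)  → contradiction (trans (x∙y⁻¹≈ε⇒x≈y _ _ p) v≈0) (^-nonzero 2 x≉0))
                               (λ x≈0 → x≈y⇒x∙y⁻¹≈ε (trans (0^n≈0 2 (s≤s z≤n) x≈0) (sym v≈0)))))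
        (≡.trans ∑δ≡1 (≡.sym (cong (λ e → 1ℤ ℤ.+ e) (η-0 v≈0))))
      (isNonsquare _ ¬sq) → ≡.trans
        (∑-cong (λ x → δ-≉0 (λ p → ¬sq (x , x∙y⁻¹≈ε⇒x≈y _ _ p))))
        (≡.trans (∑-const 0ℤ) (≡.sym (cong (λ e → 1ℤ ℤ.+ e) (η-nonsquare ¬sq))))
      (isSquare v≉0 (w , w²≈v)) → ≡.trans
        (∑-cong (λ x → two-roots x w (square-nonzero w²≈v v≉0) w²≈v))
        (≡.trans (∑-distrib _ _) (≡.trans
          (cong₂ ℤ._+_ (≡.trans (∑-translateʳ (- w)) ∑δ≡1) (≡.trans (∑-translateʳ w) ∑δ≡1))
          (≡.sym (cong (λ e → 1ℤ ℤ.+ e) (η-square v≉0 (w , w²≈v))))))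
    where
    ∑-translateʳ : ∀ c → ∑ (λ x → δ (x + c)) ≡ ∑ δ
    ∑-translateʳ c = ≡.trans (∑-cong (λ x → δ-cong (+-comm x c))) (∑-translate δ-cong c)
    two-roots : ∀ x w → w ≉ 0# → w ^ 2 ≈ v → δ (x ^ 2 - v) ≡ δ (x - w) ℤ.+ δ (x + w)
    two-roots x w w≉0 w²≈v = case (x - w) ≟ 0# of λ where
        (yes x-w≈0) → ≡.trans (δ-0 (x≈y⇒x∙y⁻¹≈ε (trans (^-congˡ 2 (x∙y⁻¹≈ε⇒x≈y x w x-w≈0)) w²≈v)))
          (≡.sym (cong₂ ℤ._+_ (δ-0 x-w≈0)
            (δ-≉0 (λ x+w≈0 → double-nonzero w≉0 (trans (+-congʳ (sym (x∙y⁻¹≈ε⇒x≈y x w x-w≈0))) x+w≈0)))))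
        (no x-w≉0) → ≡.trans
          (δ-cong-⇔ (λ p → case square-roots (trans (x∙y⁻¹≈ε⇒x≈y _ _ p) (sym w²≈v)) of λ where
                      (inj₁ x-w≈0) → contradiction x-w≈0 x-w≉0
                      (inj₂ x+w≈0) → x+w≈0)
                   (λ x+w≈0 → x≈y⇒x∙y⁻¹≈ε (trans (x+w≈0⇒x²≈w² x+w≈0) w²≈v)))
          (≡.sym (≡.trans (cong (ℤ._+ δ (x + w)) (δ-≉0 x-w≉0)) (ℤ.+-identityˡ _)))

  -- Sort the x by their square v and count the roots of each v.
  ∑-square : ∀ {C} → Congruent C → ∑ (λ x → C (x ^ 2)) ≡ ∑ (λ v → (1ℤ ℤ.+ η v) ℤ.* C v)
  ∑-square {C} C-cong = begin
    ∑ (λ x → C (x ^ 2))                            ≡⟨ ∑-cong (λ x → ∑-δ C-cong (x ^ 2)) ⟨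
    ∑ (λ x → ∑ (λ v → δ (x ^ 2 - v) ℤ.* C v))      ≡⟨ ∑-swap _ ⟩
    ∑ (λ v → ∑ (λ x → δ (x ^ 2 - v) ℤ.* C v))      ≡⟨ ∑-cong (λ v → ∑-cong λ x → ℤ.*-comm (δ (x ^ 2 - v)) (C v)) ⟩
    ∑ (λ v → ∑ (λ x → C v ℤ.* δ (x ^ 2 - v)))      ≡⟨ ∑-cong (λ v → ∑-*ˡ (C v) _) ⟩
    ∑ (λ v → C v ℤ.* ∑ (λ x → δ (x ^ 2 - v)))      ≡⟨ ∑-cong (λ v → cong (C v ℤ.*_) (#roots v)) ⟩
    ∑ (λ v → C v ℤ.* (1ℤ ℤ.+ η v))                 ≡⟨ ∑-cong (λ v → ℤ.*-comm (C v) _) ⟩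
    ∑ (λ v → (1ℤ ℤ.+ η v) ℤ.* C v)                 ∎
    where open ≡.≡-Reasoning

  -- The case C = 1 of `∑-square` counts the field in two ways.
  ∑η≡0 : ∑ η ≡ 0ℤ
  ∑η≡0 = RingProperties.+-cancelˡ ℤ.+-*-ring (+ q) _ _ (begin
    (+ q) ℤ.+ ∑ η                   ≡⟨ cong (ℤ._+ ∑ η) ∑-1 ⟨
    ∑ (λ _ → 1ℤ) ℤ.+ ∑ η            ≡⟨ ∑-distrib _ _ ⟨
    ∑ (λ v → 1ℤ ℤ.+ η v)            ≡⟨ ∑-cong (λ v → ℤ.*-identityʳ _) ⟨
    ∑ (λ v → (1ℤ ℤ.+ η v) ℤ.* 1ℤ)   ≡⟨ ∑-square {C = λ _ → 1ℤ} (λ _ → ≡.refl) ⟨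
    ∑ (λ x → 1ℤ)                    ≡⟨ ∑-1 ⟩
    + q                             ≡⟨ ℤ.+-identityʳ _ ⟨
    (+ q) ℤ.+ 0ℤ                    ∎)
    where open ≡.≡-Reasoning

  -- For a nonsquare s the summands of - Σ (η v + η (s v)) = 0 are nonnegative.
  η-nonsquare-* : ∀ {s} → s ≉ 0# → ¬ Square s → ∀ v → η (s * v) ≡ ℤ.- η v
  η-nonsquare-* {s} s≉0 ¬sq v = ≡.trans (lem (η v) (η (s * v))) (≡.trans (cong (λ d → ℤ.- d ℤ.- η v) (∑-nonNegative 0≤d ∑d≡0 d-cong v)) (ℤ.+-identityˡ _))
    where
    d : Carrier → ℤ
    d v = ℤ.- (η v ℤ.+ η (s * v))
    lem : ∀ a b → b ≡ ℤ.- ℤ.- (a ℤ.+ b) ℤ.- a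
    lem = solve-∀
    d-cong : Congruent d
    d-cong p = cong₂ (λ a b → ℤ.- (a ℤ.+ b)) (η-cong p) (η-cong (*-congˡ p))
    ∑d≡0 : ∑ d ≡ 0ℤ
    ∑d≡0 = begin
      ∑ d                                    ≡⟨ ∑-cong (λ v → ≡.sym (ℤ.-1*i≡-i _)) ⟩
      ∑ (λ v → -1ℤ ℤ.* (η v ℤ.+ η (s * v)))  ≡⟨ ∑-*ˡ -1ℤ _ ⟩
      -1ℤ ℤ.* ∑ (λ v → η v ℤ.+ η (s * v))    ≡⟨ cong (-1ℤ ℤ.*_) (∑-distrib _ _) ⟩
      -1ℤ ℤ.* (∑ η ℤ.+ ∑ (λ v → η (s * v)))  ≡⟨ cong₂ (λ a b → -1ℤ ℤ.* (a ℤ.+ b)) ∑η≡0 (≡.trans (∑-scale η-cong s≉0) ∑η≡0) ⟩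
      0ℤ                                     ∎
      where open ≡.≡-Reasoning
    values : ∀ x {a} → a ≡ -1ℤ → x ≉ 0# → 0ℤ ℤ.≤ ℤ.- (a ℤ.+ η x)
    values x ≡.refl x≉0 = case classify x of λ where
      (isZero x≈0)        → contradiction x≈0 x≉0
      (isSquare _ sq)     → ≡.subst (λ e → 0ℤ ℤ.≤ ℤ.- (-1ℤ ℤ.+ e)) (≡.sym (η-square x≉0 sq)) (ℤ.+≤+ z≤n)
      (isNonsquare _ ¬sq) → ≡.subst (λ e → 0ℤ ℤ.≤ ℤ.- (-1ℤ ℤ.+ e)) (≡.sym (η-nonsquare ¬sq)) (ℤ.+≤+ z≤n)
    0≤d : ∀ v → 0ℤ ℤ.≤ d v
    0≤d v = case classify v of λ where
      (isZero v≈0) → ≡.subst (0ℤ ℤ.≤_) (≡.sym (cong₂ (λ a b → ℤ.- (a ℤ.+ b)) (η-0 v≈0) (η-0 (trans (*-congˡ v≈0) (zeroʳ s))))) ℤ.≤-refl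
      (isSquare v≉0 sq) → ≡.subst (0ℤ ℤ.≤_)
        (≡.sym (cong₂ (λ a b → ℤ.- (a ℤ.+ b)) (η-square v≉0 sq)
          (≡.trans (η-cong (*-comm s v)) (≡.trans (η-square-* v≉0 sq s) (η-nonsquare ¬sq))))) ℤ.≤-refl
      (isNonsquare v≉0 ¬sq′) → values (s * v) (η-nonsquare ¬sq′) (*-nonzero s≉0 v≉0)

  η-* : ∀ x y → η (x * y) ≡ η x ℤ.* η y
  η-* x y = case classify x of λ where
    (isZero x≈0)          → ≡.trans (η-0 (trans (*-congʳ x≈0) (zeroˡ y))) (≡.sym (cong (ℤ._* η y) (η-0 x≈0)))
    (isSquare x≉0 sq)     → ≡.trans (η-square-* x≉0 sq y) (≡.sym (≡.trans (cong (ℤ._* η y) (η-square x≉0 sq)) (ℤ.*-identityˡ _)))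
    (isNonsquare x≉0 ¬sq) → ≡.trans (η-nonsquare-* x≉0 ¬sq y) (≡.sym (≡.trans (cong (ℤ._* η y) (η-nonsquare ¬sq)) (ℤ.-1*i≡-i _)))

  η²≡1 : ∀ {x} → x ≉ 0# → η x ℤ.* η x ≡ 1ℤ
  η²≡1 {x} x≉0 = case classify x of λ where
    (isZero x≈0)        → contradiction x≈0 x≉0
    (isSquare _ sq)     → cong₂ ℤ._*_ (η-square x≉0 sq) (η-square x≉0 sq)
    (isNonsquare _ ¬sq) → cong₂ ℤ._*_ (η-nonsquare ¬sq) (η-nonsquare ¬sq)

  η-1 : η 1# ≡ 1ℤ
  η-1 = η-square 1≉0 (1# , trans (*-identityˡ _) (*-identityˡ _))

  η-^ : ∀ x n → η (x ^ n) ≡ η x ℤ.^ n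
  η-^ x zero    = η-1
  η-^ x (suc n) = ≡.trans (η-* x (x ^ n)) (cong (η x ℤ.*_) (η-^ x n))

  -- The autocorrelation of η: what is left of Σ η(a x² + u), up to the factor η(a), once the x are
  -- sorted by the value of a x².
  correlation : Carrier → ℤ
  correlation u = ∑ (λ v → η v ℤ.* η (v + u))

  correlation-cong : Congruent correlation
  correlation-cong p = ∑-cong (λ v → cong (η v ℤ.*_) (η-cong (+-congˡ p)))

  correlation-0 : correlation 0# ≡ q∸1
  correlation-0 = begin
    ∑ (λ v → η v ℤ.* η (v + 0#))   ≡⟨ ∑-cong (λ v → cong (η v ℤ.*_) (η-cong (+-identityʳ v))) ⟩
    ∑ (λ v → η v ℤ.* η v)          ≡⟨ ∑-cong η² ⟩
    ∑ (λ v → 1ℤ ℤ.+ -1ℤ ℤ.* δ v)   ≡⟨ ∑-distrib _ _ ⟩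
    ∑ (λ _ → 1ℤ) ℤ.+ ∑ (λ v → -1ℤ ℤ.* δ v) ≡⟨ cong₂ ℤ._+_ ∑-1 (≡.trans (∑-*ˡ -1ℤ δ) (cong (-1ℤ ℤ.*_) ∑δ≡1)) ⟩
    q∸1 ∎
    where
    open ≡.≡-Reasoning
    η² : ∀ v → η v ℤ.* η v ≡ 1ℤ ℤ.+ -1ℤ ℤ.* δ v
    η² v = case v ≟ 0# of λ where
      (yes v≈0) → ≡.trans (cong₂ ℤ._*_ (η-0 v≈0) (η-0 v≈0)) (≡.sym (cong (λ d → 1ℤ ℤ.+ -1ℤ ℤ.* d) (δ-0 v≈0)))
      (no v≉0)  → ≡.trans (η²≡1 v≉0) (≡.sym (cong (λ d → 1ℤ ℤ.+ -1ℤ ℤ.* d) (δ-≉0 v≉0)))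

  -- Substituting u v for v produces η(u)² = 1.
  correlation-≉0 : ∀ {u} → u ≉ 0# → correlation u ≡ correlation 1#
  correlation-≉0 {u} u≉0 = begin
    ∑ (λ v → η v ℤ.* η (v + u))              ≡⟨ ∑-scale (λ p → cong₂ ℤ._*_ (η-cong p) (η-cong (+-congʳ p))) u≉0 ⟨
    ∑ (λ v → η (u * v) ℤ.* η (u * v + u))    ≡⟨ ∑-cong (λ v → cong₂ ℤ._*_ (η-* u v) (≡.trans (η-cong (trans (+-congˡ (sym (*-identityʳ u))) (sym (distribˡ u v 1#)))) (η-* u (v + 1#)))) ⟩
    ∑ (λ v → (η u ℤ.* η v) ℤ.* (η u ℤ.* η (v + 1#))) ≡⟨ ∑-cong (λ v → ≡.trans (lem (η u) (η v) (η (v + 1#))) (≡.trans (cong (ℤ._* _) (η²≡1 u≉0)) (ℤ.*-identityˡ _))) ⟩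
    ∑ (λ v → η v ℤ.* η (v + 1#)) ∎
    where
    open ≡.≡-Reasoning
    lem : ∀ a b c → (a ℤ.* b) ℤ.* (a ℤ.* c) ≡ (a ℤ.* a) ℤ.* (b ℤ.* c)
    lem = solve-∀

  ∑correlation≡0 : ∑ correlation ≡ 0ℤ
  ∑correlation≡0 = begin
    ∑ (λ u → ∑ (λ v → η v ℤ.* η (v + u))) ≡⟨ ∑-swap _ ⟩
    ∑ (λ v → ∑ (λ u → η v ℤ.* η (v + u))) ≡⟨ ∑-cong (λ v → ≡.trans (∑-*ˡ (η v) _) (≡.trans (cong (η v ℤ.*_) (≡.trans (∑-translate η-cong v) ∑η≡0)) (ℤ.*-zeroʳ (η v)))) ⟩
    ∑ (λ v → 0ℤ)                          ≡⟨ ∑-const 0ℤ ⟩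
    0ℤ                                    ∎
    where open ≡.≡-Reasoning

  -- All values of the correlation add up to 0, its value at 0 is q - 1, and the other q - 1 values
  -- are equal.
  correlation-1 : correlation 1# ≡ -1ℤ
  correlation-1 = cancel-q∸1 (begin
    q∸1 ℤ.* correlation 1#             ≡⟨ I-const _ ⟨
    I 0ℤ (λ _ → correlation 1#)        ≡⟨ I-cong* (λ u u≉0 → ≡.sym (correlation-≉0 u≉0)) ⟩
    I 0ℤ correlation                   ≡⟨ I-split correlation-cong ⟩
    ∑ correlation ℤ.+ -1ℤ ℤ.* correlation 0# ≡⟨ cong₂ (λ a b → a ℤ.+ -1ℤ ℤ.* b) ∑correlation≡0 correlation-0 ⟩
    0ℤ ℤ.+ -1ℤ ℤ.* q∸1                 ≡⟨ lem q∸1 ⟩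
    q∸1 ℤ.* -1ℤ                        ∎)
    where
    open ≡.≡-Reasoning
    lem : ∀ a → 0ℤ ℤ.+ -1ℤ ℤ.* a ≡ a ℤ.* -1ℤ
    lem = solve-∀

  correlation≡E : ∀ u → correlation u ≡ E u
  correlation≡E u = case u ≟ 0# of λ where
    (yes u≈0) → ≡.trans (correlation-cong u≈0) (≡.trans correlation-0 (≡.sym (E-0 u≈0)))
    (no u≉0)  → ≡.trans (correlation-≉0 u≉0) (≡.trans correlation-1 (≡.sym (E-≉0 u≉0)))

  -- Since η(a)² = 1, the weight 1 + η(v) from `∑-square` equals 1 + η(a) η(a v), and v can be
  -- substituted for a v.
  ∑-a*square : ∀ {C} → Congruent C → ∀ {a} → a ≉ 0# → ∀ u →
               ∑ (λ x → C (a * x ^ 2 + u)) ≡ ∑ C ℤ.+ η a ℤ.* ∑ (λ v → η v ℤ.* C (v + u))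
  ∑-a*square {C} C-cong {a} a≉0 u = begin
    ∑ (λ x → C (a * x ^ 2 + u))                                    ≡⟨ ∑-square (λ p → C-cong (+-congʳ (*-congˡ p))) ⟩
    ∑ (λ v → (1ℤ ℤ.+ η v) ℤ.* C (a * v + u))                       ≡⟨ ∑-cong (λ v → cong (ℤ._* C (a * v + u)) (flip-η v)) ⟩
    ∑ (λ v → (1ℤ ℤ.+ η a ℤ.* η (a * v)) ℤ.* C (a * v + u))         ≡⟨ ∑-scale (λ p → cong₂ (λ e c → (1ℤ ℤ.+ η a ℤ.* e) ℤ.* c) (η-cong p) (C-cong (+-congʳ p))) a≉0 ⟩
    ∑ (λ v → (1ℤ ℤ.+ η a ℤ.* η v) ℤ.* C (v + u))                   ≡⟨ ∑-cong (λ v → lem (η a) (η v) (C (v + u))) ⟩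
    ∑ (λ v → C (v + u) ℤ.+ η a ℤ.* (η v ℤ.* C (v + u)))            ≡⟨ ∑-distrib _ _ ⟩
    ∑ (λ v → C (v + u)) ℤ.+ ∑ (λ v → η a ℤ.* (η v ℤ.* C (v + u)))  ≡⟨ cong₂ ℤ._+_ (≡.trans (∑-cong (λ v → C-cong (+-comm v u))) (∑-translate C-cong u)) (∑-*ˡ (η a) _) ⟩
    ∑ C ℤ.+ η a ℤ.* ∑ (λ v → η v ℤ.* C (v + u))                    ∎
    where
    open ≡.≡-Reasoning
    lem : ∀ s e c → (1ℤ ℤ.+ s ℤ.* e) ℤ.* c ≡ c ℤ.+ s ℤ.* (e ℤ.* c)
    lem = solve-∀
    flip-η : ∀ v → 1ℤ ℤ.+ η v ≡ 1ℤ ℤ.+ η a ℤ.* η (a * v)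
    flip-η v = cong (λ e → 1ℤ ℤ.+ e) (≡.sym (≡.trans (cong (η a ℤ.*_) (η-* a v))
      (≡.trans (≡.sym (ℤ.*-assoc (η a) (η a) (η v))) (≡.trans (cong (ℤ._* η v) (η²≡1 a≉0)) (ℤ.*-identityˡ _)))))

  ∑η-a*square : ∀ {a} → a ≉ 0# → ∀ u → ∑ (λ x → η (a * x ^ 2 + u)) ≡ η a ℤ.* E u
  ∑η-a*square {a} a≉0 u = ≡.trans (∑-a*square η-cong a≉0 u)
    (≡.trans (cong₂ (λ s t → s ℤ.+ η a ℤ.* t) ∑η≡0 (correlation≡E u)) (ℤ.+-identityˡ _))

  -- In E = q δ - 1 the constant is killed by `∑η≡0`, while δ(v + u) selects v = -u; so η(-u) =
  -- η(-1) η(u) remains.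
  ∑E-a*square : ∀ {a} → a ≉ 0# → ∀ u → ∑ (λ x → E (a * x ^ 2 + u)) ≡ η a ℤ.* (η (- 1#) ℤ.* (+ q)) ℤ.* η u
  ∑E-a*square {a} a≉0 u = begin
    ∑ (λ x → E (a * x ^ 2 + u)) ≡⟨ ∑-a*square E-cong a≉0 u ⟩
    ∑ E ℤ.+ η a ℤ.* ∑ (λ v → η v ℤ.* E (v + u)) ≡⟨ cong₂ (λ s t → s ℤ.+ η a ℤ.* t) ∑E≡0 cross ⟩
    0ℤ ℤ.+ η a ℤ.* ((+ q) ℤ.* (η (- 1#) ℤ.* η u)) ≡⟨ lem (η a) (+ q) (η (- 1#)) (η u) ⟩
    η a ℤ.* (η (- 1#) ℤ.* (+ q)) ℤ.* η u ∎
    where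
    open ≡.≡-Reasoning
    lem : ∀ s Q p h → 0ℤ ℤ.+ s ℤ.* (Q ℤ.* (p ℤ.* h)) ≡ s ℤ.* (p ℤ.* Q) ℤ.* h
    lem = solve-∀
    lem′ : ∀ h Q d → h ℤ.* (Q ℤ.* d ℤ.- 1ℤ) ≡ Q ℤ.* (d ℤ.* h) ℤ.+ -1ℤ ℤ.* h
    lem′ = solve-∀
    cross : ∑ (λ v → η v ℤ.* E (v + u)) ≡ (+ q) ℤ.* (η (- 1#) ℤ.* η u)
    cross = begin
      ∑ (λ v → η v ℤ.* E (v + u)) ≡⟨ ∑-cong (λ v → lem′ (η v) (+ q) (δ (v + u))) ⟩
      ∑ (λ v → (+ q) ℤ.* (δ (v + u) ℤ.* η v) ℤ.+ -1ℤ ℤ.* η v) ≡⟨ ∑-distrib _ _ ⟩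
      ∑ (λ v → (+ q) ℤ.* (δ (v + u) ℤ.* η v)) ℤ.+ ∑ (λ v → -1ℤ ℤ.* η v) ≡⟨ cong₂ ℤ._+_ (∑-*ˡ (+ q) _) (≡.trans (∑-*ˡ -1ℤ η) (cong (-1ℤ ℤ.*_) ∑η≡0)) ⟩
      (+ q) ℤ.* ∑ (λ v → δ (v + u) ℤ.* η v) ℤ.+ 0ℤ ≡⟨ ℤ.+-identityʳ _ ⟩
      (+ q) ℤ.* ∑ (λ v → δ (v + u) ℤ.* η v) ≡⟨ cong ((+ q) ℤ.*_) (∑-cong (λ v → cong (ℤ._* η v) (δ-neg v))) ⟩
      (+ q) ℤ.* ∑ (λ v → δ (- u - v) ℤ.* η v) ≡⟨ cong ((+ q) ℤ.*_) (∑-δ η-cong (- u)) ⟩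
      (+ q) ℤ.* η (- u) ≡⟨ cong ((+ q) ℤ.*_) (≡.trans (η-cong (sym (-1*x≈-x u))) (η-* (- 1#) u)) ⟩
      (+ q) ℤ.* (η (- 1#) ℤ.* η u) ∎
      where
      open RingProperties ring using (-0#≈0#; -‿anti-homo-+)
      δ-neg : ∀ v → δ (v + u) ≡ δ (- u - v)
      δ-neg v = δ-cong-⇔
        (λ p → trans (sym (-‿anti-homo-+ v u)) (trans (-‿cong p) -0#≈0#))
        (λ p → trans (sym (-‿involutive _)) (trans (-‿cong (trans (-‿anti-homo-+ v u) p)) -0#≈0#))

-- Elementary symmetric polynomials and the recursion for the coefficients.

Σ< : ℕ → (ℕ → ℤ) → ℤ
Σ< zero    f = 0ℤ
Σ< (suc M) f = f 0 ℤ.+ Σ< M (f ∘ suc)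

Σ<-cong : ∀ M {f g} → f ≗ g → Σ< M f ≡ Σ< M g
Σ<-cong zero    f≗g = ≡.refl
Σ<-cong (suc M) f≗g = cong₂ ℤ._+_ (f≗g 0) (Σ<-cong M (f≗g ∘ suc))

Σ<-0 : ∀ M → Σ< M (λ _ → 0ℤ) ≡ 0ℤ
Σ<-0 zero    = ≡.refl
Σ<-0 (suc M) = cong (λ s → 0ℤ ℤ.+ s) (Σ<-0 M)

Σ<-+ : ∀ M f g → Σ< M (λ j → f j ℤ.+ g j) ≡ Σ< M f ℤ.+ Σ< M g
Σ<-+ zero    f g = ≡.refl
Σ<-+ (suc M) f g = ≡.trans (cong (λ s → f 0 ℤ.+ g 0 ℤ.+ s) (Σ<-+ M (f ∘ suc) (g ∘ suc))) (lem (f 0) (g 0) _ _)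
  where
  lem : ∀ a b c d → a ℤ.+ b ℤ.+ (c ℤ.+ d) ≡ (a ℤ.+ c) ℤ.+ (b ℤ.+ d)
  lem = solve-∀

Σ<-*ˡ : ∀ M c f → Σ< M (λ j → c ℤ.* f j) ≡ c ℤ.* Σ< M f
Σ<-*ˡ zero    c f = ≡.sym (ℤ.*-zeroʳ c)
Σ<-*ˡ (suc M) c f = ≡.trans (cong (λ s → c ℤ.* f 0 ℤ.+ s) (Σ<-*ˡ M c (f ∘ suc))) (≡.sym (ℤ.*-distribˡ-+ c (f 0) _))

Σ<-last : ∀ M f → Σ< (suc M) f ≡ Σ< M f ℤ.+ f M
Σ<-last zero    f = ℤ.+-comm (f 0) 0ℤ
Σ<-last (suc M) f = ≡.trans (cong (λ s → f 0 ℤ.+ s) (Σ<-last M (f ∘ suc))) (≡.sym (ℤ.+-assoc (f 0) _ _))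

∑₁≡Σ< : ∀ M f → ∑₁ M f ≡ Σ< M (f ∘ suc)
∑₁≡Σ< M f = go (λ i → i) M
  where
  go : ∀ g M → sumℤ (map (λ i → f (suc i)) (applyUpTo g M)) ≡ Σ< M (λ i → f (suc (g i)))
  go g zero    = ≡.refl
  go g (suc M) = cong (λ s → f (suc (g 0)) ℤ.+ s) (go (g ∘ suc) M)

sumℤ-++ : ∀ xs ys → sumℤ (xs ++ ys) ≡ sumℤ xs ℤ.+ sumℤ ys
sumℤ-++ []       ys = ≡.sym (ℤ.+-identityˡ _)
sumℤ-++ (x ∷ xs) ys = ≡.trans (cong (λ s → x ℤ.+ s) (sumℤ-++ xs ys)) (≡.sym (ℤ.+-assoc x _ _))

-- A choice of k + 1 positions either contains the first one or does not.
σ-∷ : ∀ k z zs → σ (suc k) (z ∷ zs) ≡ z ℤ.* σ k zs ℤ.+ σ (suc k) zs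
σ-∷ k z zs = ≡.trans (cong sumℤ (List.map-++ productℤ (map (z ∷_) (choose k zs)) (choose (suc k) zs)))
  (≡.trans (sumℤ-++ (map productℤ (map (z ∷_) (choose k zs))) _) (cong (ℤ._+ σ (suc k) zs) (factor (choose k zs))))
  where
  factor : ∀ xss → sumℤ (map productℤ (map (z ∷_) xss)) ≡ z ℤ.* sumℤ (map productℤ xss)
  factor []         = ≡.sym (ℤ.*-zeroʳ z)
  factor (xs ∷ xss) = ≡.trans (cong (λ s → z ℤ.* productℤ xs ℤ.+ s) (factor xss)) (≡.sym (ℤ.*-distribˡ-+ z _ _))

σ-vanish : ∀ k zs → length zs < k → σ k zs ≡ 0ℤ
σ-vanish (suc k) []       _       = ≡.refl
σ-vanish (suc k) (z ∷ zs) (s≤s p) = ≡.trans (σ-∷ k z zs)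
  (≡.trans (cong₂ (λ a b → z ℤ.* a ℤ.+ b) (σ-vanish k zs p) (σ-vanish (suc k) zs (ℕ.m<n⇒m<1+n p)))
           (≡.trans (ℤ.+-identityʳ _) (ℤ.*-zeroʳ z)))

-- Writing ε for E / q, the convolution unit of the functions of sum zero, even and odd are the coordinates of
-- ∏ⱼ (y ε + zⱼ η) with respect to ε and η, where η ∗ η = Q ε.
even odd : ℤ → ℤ → List ℤ → ℤ
even y Q []       = 1ℤ
even y Q (z ∷ zs) = y ℤ.* even y Q zs ℤ.+ z ℤ.* Q ℤ.* odd y Q zs
odd  y Q []       = 0ℤ
odd  y Q (z ∷ zs) = z ℤ.* even y Q zs ℤ.+ y ℤ.* odd y Q zs

-- With w² = Q, the product of the 1 + zⱼ w is `σ-even` plus w times `σ-odd`, provided that M is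
-- large enough for the truncation to lose nothing.
σ-even σ-odd : ℤ → ℕ → List ℤ → ℤ
σ-even Q M zs = Σ< M (λ j → σ (2 ℕ.* j) zs ℤ.* Q ℤ.^ j)
σ-odd  Q M zs = Σ< M (λ j → σ (suc (2 ℕ.* j)) zs ℤ.* Q ℤ.^ j)

σ-odd-∷ : ∀ Q M z zs → σ-odd Q M (z ∷ zs) ≡ z ℤ.* σ-even Q M zs ℤ.+ σ-odd Q M zs
σ-odd-∷ Q M z zs = begin
  Σ< M (λ j → σ (suc (2 ℕ.* j)) (z ∷ zs) ℤ.* Q ℤ.^ j)
    ≡⟨ Σ<-cong M (λ j → ≡.trans (cong (ℤ._* Q ℤ.^ j) (σ-∷ (2 ℕ.* j) z zs)) (lem z _ _ (Q ℤ.^ j))) ⟩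
  Σ< M (λ j → z ℤ.* (σ (2 ℕ.* j) zs ℤ.* Q ℤ.^ j) ℤ.+ σ (suc (2 ℕ.* j)) zs ℤ.* Q ℤ.^ j)
    ≡⟨ Σ<-+ M _ _ ⟩
  Σ< M (λ j → z ℤ.* (σ (2 ℕ.* j) zs ℤ.* Q ℤ.^ j)) ℤ.+ σ-odd Q M zs
    ≡⟨ cong (ℤ._+ σ-odd Q M zs) (Σ<-*ˡ M z _) ⟩
  z ℤ.* σ-even Q M zs ℤ.+ σ-odd Q M zs ∎
  where
  open ≡.≡-Reasoning
  lem : ∀ z a b p → (z ℤ.* a ℤ.+ b) ℤ.* p ≡ z ℤ.* (a ℤ.* p) ℤ.+ b ℤ.* p
  lem = solve-∀

-- Degree 2j + 2 draws on degree 2j + 1 of the tail. This shift costs a factor Q and makes the odd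
-- sum one term shorter.
σ-even-∷ : ∀ Q M z zs → σ-even Q (suc M) (z ∷ zs) ≡ σ-even Q (suc M) zs ℤ.+ z ℤ.* Q ℤ.* σ-odd Q M zs
σ-even-∷ Q M z zs = ≡.trans (cong (λ s → 1ℤ ℤ.+ s) (begin
  Σ< M (λ j → σ (2 ℕ.* suc j) (z ∷ zs) ℤ.* Q ℤ.^ suc j)
    ≡⟨ Σ<-cong M (λ j → ≡.trans (cong (ℤ._* Q ℤ.^ suc j) (rec j)) (lem z _ _ Q (Q ℤ.^ j))) ⟩
  Σ< M (λ j → z ℤ.* Q ℤ.* (σ (suc (2 ℕ.* j)) zs ℤ.* Q ℤ.^ j) ℤ.+ σ (2 ℕ.* suc j) zs ℤ.* Q ℤ.^ suc j)
    ≡⟨ Σ<-+ M _ _ ⟩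
  Σ< M (λ j → z ℤ.* Q ℤ.* (σ (suc (2 ℕ.* j)) zs ℤ.* Q ℤ.^ j)) ℤ.+ R
    ≡⟨ cong (ℤ._+ R) (Σ<-*ˡ M (z ℤ.* Q) _) ⟩
  z ℤ.* Q ℤ.* σ-odd Q M zs ℤ.+ R ∎)) (lem′ R _)
  where
  open ≡.≡-Reasoning
  R = Σ< M (λ j → σ (2 ℕ.* suc j) zs ℤ.* Q ℤ.^ suc j)
  lem : ∀ z a b Q p → (z ℤ.* a ℤ.+ b) ℤ.* (Q ℤ.* p) ≡ z ℤ.* Q ℤ.* (a ℤ.* p) ℤ.+ b ℤ.* (Q ℤ.* p)
  lem = solve-∀
  lem′ : ∀ r o → 1ℤ ℤ.+ (o ℤ.+ r) ≡ 1ℤ ℤ.+ r ℤ.+ o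
  lem′ = solve-∀
  rec : ∀ j → σ (2 ℕ.* suc j) (z ∷ zs) ≡ z ℤ.* σ (suc (2 ℕ.* j)) zs ℤ.+ σ (2 ℕ.* suc j) zs
  rec j = ≡.subst (λ k → σ k (z ∷ zs) ≡ z ℤ.* σ (suc (2 ℕ.* j)) zs ℤ.+ σ k zs) (≡.sym (ℕ.*-suc 2 j))
                  (σ-∷ (suc (2 ℕ.* j)) z zs)

-- For y = -1 take the sign out of each factor of ∏ⱼ (-ε + zⱼ η). The remaining product of the ε -
-- zⱼ η has σ₂ⱼ Q^j at ε, and -σ₂ⱼ₊₁ Q^j at η. The bound on the length makes the truncated sums
-- complete.
even-odd-minus-one : ∀ Q M zs → length zs < 2 ℕ.* M →
  even -1ℤ Q zs ≡ -1ℤ ℤ.^ length zs ℤ.* σ-even Q M zs ×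
  odd -1ℤ Q zs ≡ ℤ.- (-1ℤ ℤ.^ length zs) ℤ.* σ-odd Q M zs
even-odd-minus-one Q (suc M) [] _ = base-even , base-odd
  where
  base-even : 1ℤ ≡ 1ℤ ℤ.* σ-even Q (suc M) []
  base-even = ≡.sym (≡.trans (ℤ.*-identityˡ _) (cong (λ s → 1ℤ ℤ.+ s) (≡.trans (Σ<-cong M vanish) (Σ<-0 M))))
    where
    vanish : ∀ j → σ (2 ℕ.* suc j) [] ℤ.* Q ℤ.^ suc j ≡ 0ℤ
    vanish j = cong (ℤ._* Q ℤ.^ suc j) (σ-vanish (2 ℕ.* suc j) [] (s≤s z≤n))
  base-odd : 0ℤ ≡ -1ℤ ℤ.* σ-odd Q (suc M) []
  base-odd = cong (-1ℤ ℤ.*_) (≡.sym (Σ<-0 (suc M)))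
even-odd-minus-one Q (suc M) (z ∷ zs) len< with even-odd-minus-one Q (suc M) zs (ℕ.<-trans ℕ.≤-refl len<)
... | ih-even , ih-odd = (begin
    -1ℤ ℤ.* even -1ℤ Q zs ℤ.+ z ℤ.* Q ℤ.* odd -1ℤ Q zs
      ≡⟨ cong₂ (λ a b → -1ℤ ℤ.* a ℤ.+ z ℤ.* Q ℤ.* b) ih-even (≡.trans ih-odd (cong (ℤ.- s ℤ.*_) truncate)) ⟩
    -1ℤ ℤ.* (s ℤ.* e) ℤ.+ z ℤ.* Q ℤ.* (ℤ.- s ℤ.* σ-odd Q M zs)
      ≡⟨ lem s e (z ℤ.* Q) (σ-odd Q M zs) ⟩
    -1ℤ ℤ.* s ℤ.* (e ℤ.+ z ℤ.* Q ℤ.* σ-odd Q M zs)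
      ≡⟨ cong (-1ℤ ℤ.* s ℤ.*_) (σ-even-∷ Q M z zs) ⟨
    -1ℤ ℤ.* s ℤ.* σ-even Q (suc M) (z ∷ zs) ∎) , (begin
    z ℤ.* even -1ℤ Q zs ℤ.+ -1ℤ ℤ.* odd -1ℤ Q zs
      ≡⟨ cong₂ (λ a b → z ℤ.* a ℤ.+ -1ℤ ℤ.* b) ih-even ih-odd ⟩
    z ℤ.* (s ℤ.* e) ℤ.+ -1ℤ ℤ.* (ℤ.- s ℤ.* o)
      ≡⟨ lem′ s e z o ⟩
    ℤ.- (-1ℤ ℤ.* s) ℤ.* (z ℤ.* e ℤ.+ o)
      ≡⟨ cong (ℤ.- (-1ℤ ℤ.* s) ℤ.*_) (σ-odd-∷ Q (suc M) z zs) ⟨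
    ℤ.- (-1ℤ ℤ.* s) ℤ.* σ-odd Q (suc M) (z ∷ zs) ∎)
  where
  open ≡.≡-Reasoning
  s = -1ℤ ℤ.^ length zs
  e = σ-even Q (suc M) zs
  o = σ-odd Q (suc M) zs
  lem : ∀ s e x o → -1ℤ ℤ.* (s ℤ.* e) ℤ.+ x ℤ.* (ℤ.- s ℤ.* o) ≡ -1ℤ ℤ.* s ℤ.* (e ℤ.+ x ℤ.* o)
  lem = solve-∀
  lem′ : ∀ s e z o → z ℤ.* (s ℤ.* e) ℤ.+ -1ℤ ℤ.* (ℤ.- s ℤ.* o) ≡ ℤ.- (-1ℤ ℤ.* s) ℤ.* (z ℤ.* e ℤ.+ o)
  lem′ = solve-∀
  -- The odd sum may drop its last term, of degree 2M + 1, as the tail has at most 2M entries; this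
  -- gives the shorter sum that `σ-even-∷` requires.
  truncate : o ≡ σ-odd Q M zs
  truncate = ≡.trans (Σ<-last M _) (≡.trans
    (cong (λ t → σ-odd Q M zs ℤ.+ t ℤ.* Q ℤ.^ M)
      (σ-vanish (suc (2 ℕ.* M)) zs (ℕ.s<s⁻¹ (≡.subst (suc (length zs) <_) (ℕ.*-suc 2 M) len<))))
    (ℤ.+-identityʳ _))

-- For y = 0 only the product of all zⱼ η is left, a single symmetric polynomial of full degree. Two
-- factors η combine to Q ε, hence the induction in steps of two.
even-zero-even : ∀ Q r zs → length zs ≡ 2 ℕ.* r → even 0ℤ Q zs ≡ σ (2 ℕ.* r) zs ℤ.* Q ℤ.^ r
even-zero-even Q zero    []            _ = ≡.refl
even-zero-even Q (suc r) zs p =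
  ≡.subst (λ k → even 0ℤ Q zs ≡ σ k zs ℤ.* Q ℤ.^ suc r) (≡.sym (ℕ.*-suc 2 r)) (go zs (≡.trans p (ℕ.*-suc 2 r)))
  where
  open ≡.≡-Reasoning
  lem : ∀ z z′ Q e o o′ → 0ℤ ℤ.* e ℤ.+ z ℤ.* Q ℤ.* (z′ ℤ.* o ℤ.+ 0ℤ ℤ.* o′) ≡ z ℤ.* (z′ ℤ.* o) ℤ.* Q
  lem = solve-∀
  lem′ : ∀ z z′ a Q p → z ℤ.* (z′ ℤ.* (a ℤ.* p)) ℤ.* Q ≡ (z ℤ.* (z′ ℤ.* a ℤ.+ 0ℤ) ℤ.+ 0ℤ) ℤ.* (Q ℤ.* p)
  lem′ = solve-∀
  go : ∀ zs → length zs ≡ suc (suc (2 ℕ.* r)) → even 0ℤ Q zs ≡ σ (suc (suc (2 ℕ.* r))) zs ℤ.* Q ℤ.^ suc r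
  go (z ∷ z′ ∷ zs) p = begin
    0ℤ ℤ.* even 0ℤ Q (z′ ∷ zs) ℤ.+ z ℤ.* Q ℤ.* (z′ ℤ.* even 0ℤ Q zs ℤ.+ 0ℤ ℤ.* odd 0ℤ Q zs)
      ≡⟨ lem z z′ Q (even 0ℤ Q (z′ ∷ zs)) (even 0ℤ Q zs) (odd 0ℤ Q zs) ⟩
    z ℤ.* (z′ ℤ.* even 0ℤ Q zs) ℤ.* Q
      ≡⟨ cong (λ e → z ℤ.* (z′ ℤ.* e) ℤ.* Q) (even-zero-even Q r zs len) ⟩
    z ℤ.* (z′ ℤ.* (σ (2 ℕ.* r) zs ℤ.* Q ℤ.^ r)) ℤ.* Q
      ≡⟨ lem′ z z′ (σ (2 ℕ.* r) zs) Q (Q ℤ.^ r) ⟩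
    (z ℤ.* (z′ ℤ.* σ (2 ℕ.* r) zs ℤ.+ 0ℤ) ℤ.+ 0ℤ) ℤ.* (Q ℤ.* Q ℤ.^ r)
      ≡⟨ cong₂ (λ a b → (z ℤ.* (z′ ℤ.* σ (2 ℕ.* r) zs ℤ.+ a) ℤ.+ b) ℤ.* (Q ℤ.* Q ℤ.^ r))
           (σ-vanish (suc (2 ℕ.* r)) zs (s≤s (ℕ.≤-reflexive len)))
           (σ-vanish (suc (suc (2 ℕ.* r))) (z′ ∷ zs) (s≤s (s≤s (ℕ.≤-reflexive len)))) ⟨
    (z ℤ.* (z′ ℤ.* σ (2 ℕ.* r) zs ℤ.+ σ (suc (2 ℕ.* r)) zs) ℤ.+ σ (suc (suc (2 ℕ.* r))) (z′ ∷ zs)) ℤ.* (Q ℤ.* Q ℤ.^ r)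
      ≡⟨ cong (λ a → (z ℤ.* a ℤ.+ σ (suc (suc (2 ℕ.* r))) (z′ ∷ zs)) ℤ.* (Q ℤ.* Q ℤ.^ r)) (σ-∷ (2 ℕ.* r) z′ zs) ⟨
    (z ℤ.* σ (suc (2 ℕ.* r)) (z′ ∷ zs) ℤ.+ σ (suc (suc (2 ℕ.* r))) (z′ ∷ zs)) ℤ.* (Q ℤ.* Q ℤ.^ r)
      ≡⟨ cong (ℤ._* (Q ℤ.* Q ℤ.^ r)) (σ-∷ (suc (2 ℕ.* r)) z (z′ ∷ zs)) ⟨
    σ (suc (suc (2 ℕ.* r))) (z ∷ z′ ∷ zs) ℤ.* (Q ℤ.* Q ℤ.^ r) ∎
    where
    len : length zs ≡ 2 ℕ.* r
    len = ℕ.suc-injective (ℕ.suc-injective p)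

-- An odd power of η is a multiple of η and has no ε-coordinate.
even-zero-odd : ∀ Q r zs → length zs ≡ suc (2 ℕ.* r) → even 0ℤ Q zs ≡ 0ℤ
even-zero-odd Q zero    (z ∷ []) _ = ≡.trans (ℤ.+-identityˡ _) (ℤ.*-zeroʳ (z ℤ.* Q))
even-zero-odd Q (suc r) zs p = go zs (≡.trans p (cong suc (ℕ.*-suc 2 r)))
  where
  go : ∀ zs → length zs ≡ suc (suc (suc (2 ℕ.* r))) → even 0ℤ Q zs ≡ 0ℤ
  go (z ∷ z′ ∷ zs) p = ≡.trans (ℤ.+-identityˡ _)
    (≡.trans (cong (λ o → z ℤ.* Q ℤ.* o) (≡.trans (cong (λ e → z′ ℤ.* e ℤ.+ 0ℤ) (even-zero-odd Q r zs (ℕ.suc-injective (ℕ.suc-injective p)))) (≡.trans (ℤ.+-identityʳ _) (ℤ.*-zeroʳ z′)))) (ℤ.*-zeroʳ (z ℤ.* Q)))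

-- Summation over coordinates on the span of 1, E and h.

module Spectrum {c ℓ q} (F : FiniteField c ℓ q) where
  open FiniteField F hiding (zero)
  open PowerSums F
  open DiagonalSums F
  open Delta F

  -- Summing over one coordinate exchanges E and h up to constants. Keeping h abstract lets η and
  -- the zero function share one derivation; s = 0 describes a linear coordinate.
  Eigen : (Carrier → ℤ) → ℤ → Carrier → ℕ → ℤ → Set _
  Eigen h Q a e s = ∀ u → ∑ (λ x → E (a * x ^ e + u)) ≡ s ℤ.* Q ℤ.* h u × ∑ (λ x → h (a * x ^ e + u)) ≡ s ℤ.* E u

  eigen-linear : ∀ {h} → Congruent h → ∑ h ≡ 0ℤ → ∀ Q {a} → a ≉ 0# → Eigen h Q a 1 0ℤ
  eigen-linear h-cong ∑h≡0 Q a≉0 u = affine E-cong ∑E≡0 , affine h-cong ∑h≡0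
    where
    affine : ∀ {f} → Congruent f → ∑ f ≡ 0ℤ → ∑ (λ x → f (_ * x ^ 1 + u)) ≡ 0ℤ
    affine f-cong ∑f≡0 = ≡.trans (∑-cong (λ x → f-cong (+-congʳ (*-congˡ (*-identityʳ x))))) (≡.trans (∑-affine f-cong a≉0 u) ∑f≡0)

  module _ {h} (h-cong : Congruent h) (h-0 : h 0# ≡ 0ℤ) (Q : ℤ) where

    span : ℤ → ℤ → ℤ → Carrier → ℤ
    span α β γ u = α ℤ.+ (β ℤ.* E u ℤ.+ γ ℤ.* h u)

    span-cong : ∀ α β γ → Congruent (span α β γ)
    span-cong α β γ p = cong₂ (λ x y → α ℤ.+ (β ℤ.* x ℤ.+ γ ℤ.* y)) (E-cong p) (h-cong p)

    -- The sum over all x multiplies the constant by q and exchanges E and h. The correction at x =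
    -- 0 adds y times the function itself.
    I-span : ∀ z {a e s} → 0 < e → Eigen h Q a e s → ∀ α β γ u →
             let y = z ℤ.- 1ℤ in
             I z (λ x → span α β γ (a * x ^ e + u)) ≡
             span (((+ q) ℤ.+ y) ℤ.* α) (y ℤ.* β ℤ.+ s ℤ.* γ) (y ℤ.* γ ℤ.+ s ℤ.* Q ℤ.* β) u
    I-span z {a} {e} {s} 0<e eigen α β γ u = begin
      I z (λ x → span α β γ (a * x ^ e + u))
        ≡⟨ I-split (λ p → span-cong α β γ (+-congʳ (*-congˡ (^-congˡ e p)))) ⟩
      ∑ (λ x → span α β γ (a * x ^ e + u)) ℤ.+ y ℤ.* span α β γ (a * 0# ^ e + u)
        ≡⟨ cong₂ (λ s t → s ℤ.+ y ℤ.* t) ∑-span (span-cong α β γ (trans (+-congʳ (trans (*-congˡ (0^n≈0 e 0<e refl)) (zeroʳ a))) (+-identityˡ u))) ⟩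
      α ℤ.* (+ q) ℤ.+ (β ℤ.* (s ℤ.* Q ℤ.* h u) ℤ.+ γ ℤ.* (s ℤ.* E u)) ℤ.+ y ℤ.* span α β γ u
        ≡⟨ lem α β γ (+ q) s Q y (E u) (h u) ⟩
      span (((+ q) ℤ.+ y) ℤ.* α) (y ℤ.* β ℤ.+ s ℤ.* γ) (y ℤ.* γ ℤ.+ s ℤ.* Q ℤ.* β) u ∎
      where
      open ≡.≡-Reasoning
      open import Algebra.Properties.CommutativeSemiring.Exp commutativeSemiring using (^-congˡ)
      y = z ℤ.- 1ℤ
      lem : ∀ α β γ q s Q y e h →
            α ℤ.* q ℤ.+ (β ℤ.* (s ℤ.* Q ℤ.* h) ℤ.+ γ ℤ.* (s ℤ.* e)) ℤ.+ y ℤ.* (α ℤ.+ (β ℤ.* e ℤ.+ γ ℤ.* h)) ≡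
            (q ℤ.+ y) ℤ.* α ℤ.+ ((y ℤ.* β ℤ.+ s ℤ.* γ) ℤ.* e ℤ.+ (y ℤ.* γ ℤ.+ s ℤ.* Q ℤ.* β) ℤ.* h)
      lem = solve-∀
      ∑-span : ∑ (λ x → span α β γ (a * x ^ e + u)) ≡ α ℤ.* (+ q) ℤ.+ (β ℤ.* (s ℤ.* Q ℤ.* h u) ℤ.+ γ ℤ.* (s ℤ.* E u))
      ∑-span = ≡.trans (∑-distrib _ _) (cong₂ ℤ._+_ (∑-const α) (≡.trans (∑-distrib _ _)
        (cong₂ ℤ._+_ (≡.trans (∑-*ˡ β _) (cong (β ℤ.*_) (proj₁ (eigen u))))
                     (≡.trans (∑-*ˡ γ _) (cong (γ ℤ.*_) (proj₂ (eigen u)))))))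

    -- The first coordinate is moved innermost, where `I-span` merely changes the coefficients. When
    -- no coordinate is left, evaluation at 0 gives E(0) = q - 1 and h(0) = 0, whence the factor
    -- `q∸1`.
    W-span : ∀ z {n} (a : Vector Carrier n) e (s : Vector ℤ n) → (∀ j → 0 < e j) → (∀ j → Eigen h Q (a j) (e j) (s j)) →
             ∀ α β γ → let y = z ℤ.- 1ℤ; zs = tabulate s in
             W z a e (span α β γ) ≡ ((+ q) ℤ.+ y) ℤ.^ n ℤ.* α ℤ.+ q∸1 ℤ.* (even y Q zs ℤ.* β ℤ.+ odd y Q zs ℤ.* γ)
    W-span z {zero} a e s 0<e eigen α β γ = ≡.trans (cong₂ (λ x y → α ℤ.+ (β ℤ.* x ℤ.+ γ ℤ.* y)) (E-0 refl) h-0) (lem α β γ q∸1)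
      where
      lem : ∀ α β γ r → α ℤ.+ (β ℤ.* r ℤ.+ γ ℤ.* 0ℤ) ≡ 1ℤ ℤ.* α ℤ.+ r ℤ.* (1ℤ ℤ.* β ℤ.+ 0ℤ ℤ.* γ)
      lem = solve-∀
    W-span z {suc n} a e s 0<e eigen α β γ = begin
      I z (λ x → W z (tail a) (tail e) (λ u → span α β γ (head a * x ^ head e + u)))
        ≡⟨ W-swap (tail a) (tail e) (λ x u → span α β γ (head a * x ^ head e + u)) ⟩
      W z (tail a) (tail e) (λ u → I z (λ x → span α β γ (head a * x ^ head e + u)))
        ≡⟨ W-cong (tail a) (tail e) (I-span z {s = s₀} (0<e Fin.zero) (eigen Fin.zero) α β γ) ⟩
      W z (tail a) (tail e) (span (((+ q) ℤ.+ y) ℤ.* α) (y ℤ.* β ℤ.+ s₀ ℤ.* γ) (y ℤ.* γ ℤ.+ s₀ ℤ.* Q ℤ.* β))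
        ≡⟨ W-span z (tail a) (tail e) (tail s) (0<e ∘ suc) (eigen ∘ suc) _ _ _ ⟩
      ((+ q) ℤ.+ y) ℤ.^ n ℤ.* (((+ q) ℤ.+ y) ℤ.* α) ℤ.+
      q∸1 ℤ.* (even y Q zs ℤ.* (y ℤ.* β ℤ.+ s₀ ℤ.* γ) ℤ.+ odd y Q zs ℤ.* (y ℤ.* γ ℤ.+ s₀ ℤ.* Q ℤ.* β))
        ≡⟨ lem (((+ q) ℤ.+ y) ℤ.^ n) ((+ q) ℤ.+ y) α β γ y s₀ Q q∸1 (even y Q zs) (odd y Q zs) ⟩
      ((+ q) ℤ.+ y) ℤ.* ((+ q) ℤ.+ y) ℤ.^ n ℤ.* α ℤ.+
      q∸1 ℤ.* ((y ℤ.* even y Q zs ℤ.+ s₀ ℤ.* Q ℤ.* odd y Q zs) ℤ.* β ℤ.+ (s₀ ℤ.* even y Q zs ℤ.+ y ℤ.* odd y Q zs) ℤ.* γ) ∎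
      where
      open ≡.≡-Reasoning
      y = z ℤ.- 1ℤ
      s₀ = head s
      zs = tabulate (tail s)
      lem : ∀ p x α β γ y s Q r B G →
            p ℤ.* (x ℤ.* α) ℤ.+ r ℤ.* (B ℤ.* (y ℤ.* β ℤ.+ s ℤ.* γ) ℤ.+ G ℤ.* (y ℤ.* γ ℤ.+ s ℤ.* Q ℤ.* β)) ≡
            x ℤ.* p ℤ.* α ℤ.+ r ℤ.* ((y ℤ.* B ℤ.+ s ℤ.* Q ℤ.* G) ℤ.* β ℤ.+ (s ℤ.* B ℤ.+ y ℤ.* G) ℤ.* γ)
      lem = solve-∀

    q*W-δ : ∀ z {n} (a : Vector Carrier n) e (s : Vector ℤ n) → (∀ j → 0 < e j) → (∀ j → Eigen h Q (a j) (e j) (s j)) →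
            (+ q) ℤ.* W z a e δ ≡ ((+ q) ℤ.+ (z ℤ.- 1ℤ)) ℤ.^ n ℤ.+ q∸1 ℤ.* even (z ℤ.- 1ℤ) Q (tabulate s)
    q*W-δ z {n} a e s 0<e eigen = begin
      (+ q) ℤ.* W z a e δ             ≡⟨ W-*ˡ a e (+ q) δ ⟨
      W z a e (λ u → (+ q) ℤ.* δ u)   ≡⟨ W-cong a e (λ u → lem ((+ q) ℤ.* δ u) (h u)) ⟩
      W z a e (span 1ℤ 1ℤ 0ℤ)         ≡⟨ W-span z a e s 0<e eigen 1ℤ 1ℤ 0ℤ ⟩
      _                               ≡⟨ lem′ (((+ q) ℤ.+ (z ℤ.- 1ℤ)) ℤ.^ n) q∸1 _ (odd (z ℤ.- 1ℤ) Q (tabulate s)) ⟩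
      ((+ q) ℤ.+ (z ℤ.- 1ℤ)) ℤ.^ n ℤ.+ q∸1 ℤ.* even (z ℤ.- 1ℤ) Q (tabulate s) ∎
      where
      open ≡.≡-Reasoning
      lem : ∀ d h → d ≡ 1ℤ ℤ.+ (1ℤ ℤ.* (d ℤ.- 1ℤ) ℤ.+ 0ℤ ℤ.* h)
      lem = solve-∀
      lem′ : ∀ p r B G → p ℤ.* 1ℤ ℤ.+ r ℤ.* (B ℤ.* 1ℤ ℤ.+ G ℤ.* 0ℤ) ≡ p ℤ.+ r ℤ.* B
      lem′ = solve-∀
      W-*ˡ : ∀ {n} (a : Vector Carrier n) e c C → W z a e (λ u → c ℤ.* C u) ≡ c ℤ.* W z a e C
      W-*ˡ {zero}  a e c C = ≡.refl
      W-*ˡ {suc n} a e c C = ≡.trans (I-cong (λ x → W-*ˡ (tail a) (tail e) c _)) (I-*ˡ c _)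

-- Coprimality of the exponents, and passage to the rationals.

coprime-product : ∀ {m n} (d : Vector ℕ n) → (∀ j → Coprime m (d j)) → Coprime m (Vector.foldr ℕ._*_ 1 d)
coprime-product {n = zero}  d coprime (_ , g∣1)  = ∣1⇒≡1 g∣1
coprime-product {n = suc n} d coprime (g∣m , g∣P) = coprime-product (tail d) (coprime ∘ suc)
  (g∣m , coprime-divisor (λ (h∣g , h∣d) → coprime zero (∣-trans h∣g g∣m , h∣d)) g∣P)

∣-product : ∀ {n} (d : Vector ℕ n) j → d j ∣ Vector.foldr ℕ._*_ 1 d
∣-product d zero    = m∣m*n _
∣-product d (suc j) = ∣-trans (∣-product (tail d) j) (n∣m*n (head d))

-- Let P be the product of the later `d′` and M = 2 P. A common divisor of d₀ and M divides both 2
-- d′₀ and 2 P, hence 2, since d′₀ is coprime to P. Working with d ∣ 2 d′ treats odd and even d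
-- alike.
separated : ∀ {n} (d d′ : Vector ℕ n) → (∀ j → d j ∣ d′ j ℕ.* 2) → (∀ i j → i ≢ j → Coprime (d′ i) (d′ j)) → Separated d
separated {zero}  d d′ d∣2d′ coprime = tt
separated {suc n} d d′ d∣2d′ coprime =
  (P ℕ.* 2 , n∣m*n P , (λ j → ∣-trans (d∣2d′ (suc j)) (*-monoˡ-∣ 2 (∣-product (tail d′) j))) , ∣-antisym
    (gcd-greatest (gcd[m,n]∣m (head d) _)
      (coprime-factors (coprime-product (tail d′) (λ j → coprime zero (suc j) (λ ())))
        (∣-trans (gcd[m,n]∣m (head d) _) (d∣2d′ zero) , gcd[m,n]∣n (head d) _)))
    (gcd-greatest (gcd[m,n]∣m (head d) 2) (∣-trans (gcd[m,n]∣n (head d) 2) (n∣m*n P)))) ,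
  separated (tail d) (tail d′) (d∣2d′ ∘ suc) (λ i j i≢j → coprime (suc i) (suc j) (i≢j ∘ Fin.suc-injective))
  where
  P = Vector.foldr ℕ._*_ 1 (tail d′)

foldr-gcd-∣ : ∀ {n} (ks : Vector ℕ n) N j → Vector.foldr gcd N ks ∣ ks j
foldr-gcd-∣ ks N zero    = gcd[m,n]∣m (head ks) _
foldr-gcd-∣ ks N (suc j) = ∣-trans (gcd[m,n]∣n (head ks) _) (foldr-gcd-∣ (tail ks) N j)

2∤⇒gcd≡1 : ∀ {d} → 2 ∤ d → gcd d 2 ≡ 1
2∤⇒gcd≡1 {d} 2∤d with gcd d 2 | gcd[m,n]∣m d 2 | gcd[m,n]∣n d 2
... | 0 | _ | 0∣2 = contradiction (0∣⇒≡0 0∣2) (λ ())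
... | 1 | _ | _ = ≡.refl
... | 2 | 2∣d | _ = contradiction 2∣d 2∤d
... | suc (suc (suc g)) | _ | g∣2 = contradiction (∣⇒≤ g∣2) (λ { (s≤s (s≤s ())) })

2∣⇒gcd≡2 : ∀ {d} → 2 ∣ d → gcd d 2 ≡ 2
2∣⇒gcd≡2 {d} 2∣d = ∣-antisym (gcd[m,n]∣n d 2) (gcd-greatest 2∣d ∣-refl)

fromℤ-- : ∀ x y → fromℤ (x ℤ.- y) ≡ fromℤ x ℚ.- fromℤ y
fromℤ-- x y = ℚ.toℚᵘ-injective (begin
  ℚ.toℚᵘ (fromℤ (x ℤ.- y))                  ≈⟨ ℚ.toℚᵘ-fromℚᵘ (mkℚᵘ (x ℤ.- y) 0) ⟩
  mkℚᵘ (x ℤ.- y) 0                           ≈⟨ *≡* (lem x y) ⟩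
  mkℚᵘ x 0 ℚᵘ.- mkℚᵘ y 0                     ≈⟨ ℚᵘ.+-cong (ℚ.toℚᵘ-fromℚᵘ (mkℚᵘ x 0)) (ℚᵘ.-‿cong (ℚ.toℚᵘ-fromℚᵘ (mkℚᵘ y 0))) ⟨
  ℚ.toℚᵘ (fromℤ x) ℚᵘ.- ℚ.toℚᵘ (fromℤ y)    ≈⟨ ℚᵘ.+-congʳ (ℚ.toℚᵘ (fromℤ x)) (ℚ.toℚᵘ-homo‿- (fromℤ y)) ⟨
  ℚ.toℚᵘ (fromℤ x) ℚᵘ.+ ℚ.toℚᵘ (ℚ.- fromℤ y) ≈⟨ ℚ.toℚᵘ-homo-+ (fromℤ x) (ℚ.- fromℤ y) ⟨
  ℚ.toℚᵘ (fromℤ x ℚ.- fromℤ y)              ∎)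
  where
  open ℚᵘ.≃-Reasoning
  lem : ∀ x y → (x ℤ.- y) ℤ.* 1ℤ ≡ (x ℤ.* 1ℤ ℤ.+ (ℤ.- y) ℤ.* 1ℤ) ℤ.* 1ℤ
  lem = solve-∀

n*z/n≡z : ∀ n .{{_ : NonZero n}} z → (+ n ℤ.* z) ℚ./ n ≡ fromℤ z
n*z/n≡z (suc n) z = ℚ.fromℚᵘ-cong {mkℚᵘ (+ suc n ℤ.* z) n} {mkℚᵘ z 0} (*≡* (≡.trans (ℤ.*-identityʳ _) (ℤ.*-comm (+ suc n) z)))

-- Each of the t linear coordinates has zⱼ = 0 and so contributes the bare factor y ε.
shifted-even : ∀ y Q {n} (f : Vector ℤ n) t → t ≤ n →
               even y Q (tabulate (λ j → if toℕ j <ᵇ t then 0ℤ else f j)) ≡ y ℤ.^ t ℤ.* even y Q (drop t (tabulate f))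
shifted-even y Q f zero _ = ≡.sym (ℤ.*-identityˡ _)
shifted-even y Q {suc n} f (suc t) (s≤s t≤n) = begin
  y ℤ.* even y Q zs ℤ.+ 0ℤ                                ≡⟨ ℤ.+-identityʳ _ ⟩
  y ℤ.* even y Q zs                                       ≡⟨ cong (y ℤ.*_) (shifted-even y Q (tail f) t t≤n) ⟩
  y ℤ.* (y ℤ.^ t ℤ.* even y Q (drop t (tabulate (tail f))))   ≡⟨ ℤ.*-assoc y _ _ ⟨
  y ℤ.* y ℤ.^ t ℤ.* even y Q (drop t (tabulate (tail f)))     ∎
  where
  open ≡.≡-Reasoning
  zs = tabulate (λ j → if toℕ j <ᵇ t then 0ℤ else tail f j)

-- From solutions to diagonal sums.

module Counting {c ℓ q} (F : FiniteField c ℓ q) where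
  open FiniteField F hiding (zero)
  open PowerSums F
  open DiagonalSums F
  open Delta F
  open Exp commutativeSemiring using (^-congˡ; ^-distrib-*; ^-assocʳ)
  open Inverse enumeration using (from)

  indicator : ∀ {p} {P : Set p} → Dec P → ℤ
  indicator P? = if does P? then 1ℤ else 0ℤ

  tupleSum : ℤ → ∀ n → (Vector Carrier n → ℤ) → ℤ
  tupleSum z zero    g = g Vector.[]
  tupleSum z (suc n) g = I z (λ x → tupleSum z n (λ v → g (x Vector.∷ v)))

  opaque
    unfolding ∑ I

    count-suc : ∀ {p n} {P : Vector Carrier (suc n) → Set p} (P? : U.Decidable P) →
                + count P? ≡ I 1ℤ (λ x → + count (λ v → P? (x Vector.∷ v)))
    count-suc {n = n} P? = ≡.trans
      (cong (λ xs → + length (filter P? (cartesianProductWith Vector._∷_ xs (tuples n)))) (List.map-tabulate (λ i → i) from))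
      (rows from)
      where
      column : ∀ x vs → length (filter P? (map (x Vector.∷_) vs)) ≡ length (filter (λ v → P? (x Vector.∷ v)) vs)
      column x [] = ≡.refl
      column x (v ∷ vs) with does (P? (x Vector.∷ v))
      ... | true  = cong suc (column x vs)
      ... | false = column x vs
      weight-1 : ∀ x → weight 1ℤ x ≡ 1ℤ
      weight-1 x = case x ≟ 0# of λ where
        (yes x≈0) → weight-0 x≈0
        (no x≉0)  → weight-≉0 x≉0
      rows : ∀ {m} (g : Fin m → Carrier) →
             + length (filter P? (cartesianProductWith Vector._∷_ (tabulate g) (tuples n))) ≡
             ℤSum.sum (λ i → weight 1ℤ (g i) ℤ.* + count (λ v → P? (g i Vector.∷ v)))
      rows {zero}  g = ≡.refl
      rows {suc m} g = ≡.trans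
        (cong (λ xs → + length xs) (List.filter-++ P? (map (g zero Vector.∷_) (tuples n)) rest))
        (≡.trans (cong (λ k → + k) (List.length-++ (filter P? (map (g zero Vector.∷_) (tuples n)))))
        (≡.trans (ℤ.pos-+ (length (filter P? (map (g zero Vector.∷_) (tuples n)))) _)
        (cong₂ ℤ._+_
          (≡.trans (cong (λ k → + k) (column (g zero) (tuples n)))
            (≡.sym (≡.trans (cong (ℤ._* + count (λ v → P? (g zero Vector.∷ v))) (weight-1 (g zero))) (ℤ.*-identityˡ _))))
          (rows (g ∘ suc)))))
        where
        rest : List (Vector Carrier (suc n))
        rest = cartesianProductWith Vector._∷_ (tabulate (g ∘ suc)) (tuples n)

  count≡tupleSum : ∀ {p n} {P : Vector Carrier n → Set p} (P? : U.Decidable P) →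
                   + count P? ≡ tupleSum 1ℤ n (λ x → indicator (P? x))
  count≡tupleSum {n = zero} P? with does (P? Vector.[])
  ... | true  = ≡.refl
  ... | false = ≡.refl
  count≡tupleSum {n = suc n} P? = ≡.trans (count-suc P?) (I-cong (λ x → count≡tupleSum (λ v → P? (x Vector.∷ v))))

  tupleSum-cong : ∀ {z} n {f g} → f ≗ g → tupleSum z n f ≡ tupleSum z n g
  tupleSum-cong zero    f≗g = f≗g Vector.[]
  tupleSum-cong (suc n) f≗g = I-cong (λ x → tupleSum-cong n (λ v → f≗g (x Vector.∷ v)))

  tupleSum-+ : ∀ {z} n f g → tupleSum z n (λ x → f x ℤ.+ g x) ≡ tupleSum z n f ℤ.+ tupleSum z n g
  tupleSum-+ zero    f g = ≡.refl
  tupleSum-+ (suc n) f g = ≡.trans (I-cong (λ x → tupleSum-+ n (λ v → f (x Vector.∷ v)) (λ v → g (x Vector.∷ v)))) (I-+ _ _)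

  tupleSum-*ˡ : ∀ {z} n c f → tupleSum z n (λ x → c ℤ.* f x) ≡ c ℤ.* tupleSum z n f
  tupleSum-*ˡ zero    c f = ≡.refl
  tupleSum-*ˡ (suc n) c f = ≡.trans (I-cong (λ x → tupleSum-*ˡ n c (λ v → f (x Vector.∷ v)))) (I-*ˡ c _)

  tupleSum-diagonal : ∀ {z n} (a : Vector Carrier n) m C →
                      tupleSum z n (λ x → C (sum (λ j → a j * x j ^ m j))) ≡ W z a m C
  tupleSum-diagonal {n = zero}  a m C = ≡.refl
  tupleSum-diagonal {n = suc n} a m C = I-cong (λ x → tupleSum-diagonal (tail a) (tail m) (λ u → C (head a * x ^ head m + u)))

  -- The indicator of the tuples without zero coordinate. It rewrites the restricted count as a sum
  -- over all tuples, so that the two counts can be compared term by term.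
  support : ∀ {n} → Vector Carrier n → ℤ
  support x = Vector.foldr (λ y s → weight 0ℤ y ℤ.* s) 1ℤ x

  opaque
    unfolding ∑ I

    I-weight : ∀ f → I 0ℤ f ≡ I 1ℤ (λ x → weight 0ℤ x ℤ.* f x)
    I-weight f = ∑-cong (λ x → case x ≟ 0# of λ where
      (yes x≈0) → ≡.trans (cong (ℤ._* f x) (weight-0 x≈0)) (≡.sym (cong₂ (λ v w → v ℤ.* (w ℤ.* f x)) (weight-0 x≈0) (weight-0 x≈0)))
      (no x≉0)  → ≡.trans (≡.sym (ℤ.*-identityˡ _)) (cong (ℤ._* (weight 0ℤ x ℤ.* f x)) (≡.sym (weight-≉0 x≉0))))

  tupleSum-support : ∀ n f → tupleSum 0ℤ n f ≡ tupleSum 1ℤ n (λ x → support x ℤ.* f x)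
  tupleSum-support zero    f = ≡.sym (ℤ.*-identityˡ _)
  tupleSum-support (suc n) f = begin
    I 0ℤ (λ x → tupleSum 0ℤ n (λ v → f (x Vector.∷ v)))
      ≡⟨ I-cong (λ x → tupleSum-support n (λ v → f (x Vector.∷ v))) ⟩
    I 0ℤ (λ x → tupleSum 1ℤ n (λ v → support v ℤ.* f (x Vector.∷ v)))
      ≡⟨ I-weight _ ⟩
    I 1ℤ (λ x → weight 0ℤ x ℤ.* tupleSum 1ℤ n (λ v → support v ℤ.* f (x Vector.∷ v)))
      ≡⟨ I-cong (λ x → tupleSum-*ˡ n (weight 0ℤ x) _) ⟨
    I 1ℤ (λ x → tupleSum 1ℤ n (λ v → weight 0ℤ x ℤ.* (support v ℤ.* f (x Vector.∷ v))))
      ≡⟨ I-cong (λ x → tupleSum-cong n (λ v → ≡.sym (ℤ.*-assoc (weight 0ℤ x) (support v) _))) ⟩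
    I 1ℤ (λ x → tupleSum 1ℤ n (λ v → support (x Vector.∷ v) ℤ.* f (x Vector.∷ v))) ∎
    where open ≡.≡-Reasoning

  support-cases : ∀ {n} (x : Vector Carrier n) → (∃ λ j → x j ≈ 0# × support x ≡ 0ℤ) ⊎ ((∀ j → x j ≉ 0#) × support x ≡ 1ℤ)
  support-cases {zero}  x = inj₂ ((λ ()) , ≡.refl)
  support-cases {suc n} x = case head x ≟ 0# of λ where
    (yes x≈0) → inj₁ (zero , x≈0 , cong (ℤ._* support (tail x)) (weight-0 x≈0))
    (no x≉0)  → case support-cases (tail x) of λ where
      (inj₁ (j , xⱼ≈0 , supp≡0)) → inj₁ (suc j , xⱼ≈0 , ≡.trans (cong (weight 0ℤ (head x) ℤ.*_) supp≡0) (ℤ.*-zeroʳ (weight 0ℤ (head x))))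
      (inj₂ (all≉0 , supp≡1)) → inj₂ ((λ { zero → x≉0 ; (suc j) → all≉0 j }) , cong₂ ℤ._*_ (weight-≉0 x≉0) supp≡1)

  product-zero : ∀ {n} (x : Vector Carrier n) j → x j ≈ 0# → product x ≈ 0#
  product-zero x zero    p = trans (*-congʳ p) (zeroˡ _)
  product-zero x (suc j) p = trans (*-congˡ (product-zero (tail x) j p)) (zeroʳ _)

  product-nonzero : ∀ {n} (x : Vector Carrier n) → (∀ j → x j ≉ 0#) → product x ≉ 0#
  product-nonzero {zero}  x x≉0 = 1≉0
  product-nonzero {suc n} x x≉0 = *-nonzero (x≉0 zero) (product-nonzero (tail x) (x≉0 ∘ suc))

  1^n≈1 : ∀ n → 1# ^ n ≈ 1#
  1^n≈1 zero    = refl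
  1^n≈1 (suc n) = trans (*-identityˡ _) (1^n≈1 n)

  isPower-^ : ∀ {k₀ k} → k₀ ∣ k → ∀ x → IsPower k₀ (x ^ k)
  isPower-^ {k₀} (divides k′ ≡.refl) x = x ^ k′ , ^-assocʳ x k′ k₀

  isPower-product : ∀ {n} k (x : Vector Carrier n) → (∀ j → IsPower k (x j)) → IsPower k (product x)
  isPower-product {zero}  k x powers = 1# , 1^n≈1 k
  isPower-product {suc n} k x powers with powers zero | isPower-product k (tail x) (powers ∘ suc)
  ... | y , yᵏ≈x | z , zᵏ≈p = y * z , trans (^-distrib-* y z k) (*-cong yᵏ≈x zᵏ≈p)

  -- For a solution without zero coordinates, the left side of the equation and the monomial on the
  -- right are both k₀th powers, the latter nonzero; dividing would make b a k₀th power.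
  isPower-cancel : ∀ k {b p} → 0 < k → p ≉ 0# → IsPower k p → IsPower k (b * p) → IsPower k b
  isPower-cancel k {b} {p} 0<k p≉0 (y , yᵏ≈p) (s , sᵏ≈bp) with inverse y (λ y≈0 → p≉0 (trans (sym yᵏ≈p) (0^n≈0 k 0<k y≈0)))
  ... | y′ , yy′≈1 = s * y′ , *-cancelˡ p≉0 (≈.begin
    p * (s * y′) ^ k          ≈.≈⟨ *-cong (sym yᵏ≈p) (^-distrib-* s y′ k) ⟩
    y ^ k * (s ^ k * y′ ^ k)  ≈.≈⟨ *-comm _ _ ⟩
    s ^ k * y′ ^ k * y ^ k    ≈.≈⟨ *-assoc _ _ _ ⟩
    s ^ k * (y′ ^ k * y ^ k)  ≈.≈⟨ *-congˡ (^-distrib-* y′ y k) ⟨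
    s ^ k * (y′ * y) ^ k      ≈.≈⟨ *-cong sᵏ≈bp (^-congˡ k (trans (*-comm y′ y) yy′≈1)) ⟩
    b * p * 1# ^ k            ≈.≈⟨ *-congˡ (1^n≈1 k) ⟩
    b * p * 1#                ≈.≈⟨ *-identityʳ _ ⟩
    b * p                     ≈.≈⟨ *-comm b p ⟩
    p * b                     ≈.∎)

  -- Since b is not a k₀th power, every solution has a vanishing coordinate, hence also a vanishing sum.
  solutions : ∀ {n} (a : Vector Carrier n) {b} → b ≉ 0# → ∀ {k} → 0 < k →
              ∀ (ks : Vector ℕ n) → (∀ j → 0 < ks j) → ∀ m →
              ∀ {k₀} → 0 < k₀ → k₀ ∣ k → (∀ j → k₀ ∣ ks j) → ¬ IsPower k₀ b →
              + count {n = n} (λ x → sum (λ j → a j * x j ^ m j) ^ k ≟ b * product (λ j → x j ^ ks j)) ≡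
              W 1ℤ a m δ ℤ.- W 0ℤ a m δ
  solutions {n} a {b} b≉0 {k} 0<k ks 0<ks m {k₀} 0<k₀ k₀∣k k₀∣ks ¬power = begin
    + count P?
      ≡⟨ count≡tupleSum P? ⟩
    tupleSum 1ℤ n (λ x → indicator (P? x))
      ≡⟨ tupleSum-cong n pointwise ⟩
    tupleSum 1ℤ n (λ x → δ (S x) ℤ.+ -1ℤ ℤ.* (support x ℤ.* δ (S x)))
      ≡⟨ tupleSum-+ n (δ ∘ S) (λ x → -1ℤ ℤ.* (support x ℤ.* δ (S x))) ⟩
    tupleSum 1ℤ n (δ ∘ S) ℤ.+ tupleSum 1ℤ n (λ x → -1ℤ ℤ.* (support x ℤ.* δ (S x)))
      ≡⟨ cong₂ ℤ._+_ (tupleSum-diagonal a m δ) (tupleSum-*ˡ n -1ℤ (λ x → support x ℤ.* δ (S x))) ⟩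
    W 1ℤ a m δ ℤ.+ -1ℤ ℤ.* tupleSum 1ℤ n (λ x → support x ℤ.* δ (S x))
      ≡⟨ cong (λ s → W 1ℤ a m δ ℤ.+ -1ℤ ℤ.* s) (≡.trans (≡.sym (tupleSum-support n (δ ∘ S))) (tupleSum-diagonal a m δ)) ⟩
    W 1ℤ a m δ ℤ.+ -1ℤ ℤ.* W 0ℤ a m δ
      ≡⟨ cong (λ s → W 1ℤ a m δ ℤ.+ s) (ℤ.-1*i≡-i _) ⟩
    W 1ℤ a m δ ℤ.- W 0ℤ a m δ ∎
    where
    open ≡.≡-Reasoning
    S Π : Vector Carrier n → Carrier
    S x = sum (λ j → a j * x j ^ m j)
    Π x = product (λ j → x j ^ ks j)
    P? : ∀ x → Dec (S x ^ k ≈ b * Π x)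
    P? x = S x ^ k ≟ b * Π x
    pointwise : ∀ x → indicator (P? x) ≡ δ (S x) ℤ.+ -1ℤ ℤ.* (support x ℤ.* δ (S x))
    pointwise x = case support-cases x of λ where
        (inj₁ (j , xⱼ≈0 , supp≡0)) →
          let bΠ≈0 = trans (*-congˡ (product-zero _ j (0^n≈0 (ks j) (0<ks j) xⱼ≈0))) (zeroʳ b)
          in ≡.trans
            (case S x ≟ 0# of λ where
              (yes S≈0) → ≡.trans (cong (if_then 1ℤ else 0ℤ) (dec-true (P? x) (trans (0^n≈0 k 0<k S≈0) (sym bΠ≈0)))) (≡.sym (δ-0 S≈0))
              (no S≉0)  → ≡.trans (cong (if_then 1ℤ else 0ℤ) (dec-false (P? x) (λ p → ^-nonzero k S≉0 (trans p bΠ≈0)))) (≡.sym (δ-≉0 S≉0)))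
            (≡.sym (≡.trans (cong (λ s → δ (S x) ℤ.+ -1ℤ ℤ.* (s ℤ.* δ (S x))) supp≡0) (ℤ.+-identityʳ _)))
        (inj₂ (x≉0 , supp≡1)) → ≡.trans
          (cong (if_then 1ℤ else 0ℤ) (dec-false (P? x) (λ p → ¬power
            (isPower-cancel k₀ 0<k₀ (product-nonzero _ (λ j → ^-nonzero (ks j) (x≉0 j)))
              (isPower-product k₀ _ (λ j → isPower-^ (k₀∣ks j) (x j)))
              (let y , yᵏ = isPower-^ k₀∣k (S x) in y , trans yᵏ p)))))
          (≡.sym (≡.trans (cong (λ s → δ (S x) ℤ.+ -1ℤ ℤ.* (s ℤ.* δ (S x))) supp≡1) (lem (δ (S x)))))
      where
      lem : ∀ d → d ℤ.+ -1ℤ ℤ.* (1ℤ ℤ.* d) ≡ 0ℤ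
      lem = solve-∀

-- The indices j = 0, ..., [m / 2] reach every even degree up to m, so a truncation after 1 +
-- [m / 2] terms is exact.
m<2*[1+m/2] : ∀ m → m < 2 ℕ.* suc (m / 2)
m<2*[1+m/2] m = ≡.subst₂ _<_ (≡.sym (m≡m%n+[m/n]*n m 2)) (ℕ.*-comm (suc (m / 2)) 2) (ℕ.+-monoˡ-< (m / 2 ℕ.* 2) (m%n<n m 2))

odd⇒1+2*[m/2] : ∀ {m} → 2 ∤ m → m ≡ suc (2 ℕ.* (m / 2))
odd⇒1+2*[m/2] {m} 2∤m with m % 2 in m%2≡ | m%n<n m 2
... | 0 | _ = contradiction (m%n≡0⇒n∣m m 2 m%2≡) 2∤m
... | 1 | _ = ≡.trans (m≡m%n+[m/n]*n m 2) (cong₂ ℕ._+_ m%2≡ (ℕ.*-comm (m / 2) 2))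
... | suc (suc _) | s≤s (s≤s ())

<ᵇ-cases : ∀ m n → (m < n × (m <ᵇ n) ≡ true) ⊎ (n ≤ m × (m <ᵇ n) ≡ false)
<ᵇ-cases m n with m <ᵇ n in eq
... | true  = inj₁ (ℕ.<ᵇ⇒< m n (≡.subst T (≡.sym eq) tt) , ≡.refl)
... | false = inj₂ (ℕ.≮⇒≥ (λ m<n → ≡.subst T eq (ℕ.<⇒<ᵇ m<n)) , ≡.refl)

-- Evaluation of the number of solutions.

module SolutionCount {c ℓ q} (F : FiniteField c ℓ q) where
  open FiniteField F hiding (zero)
  open PowerSums F
  open DiagonalSums F
  open Delta F
  open Spectrum F

  r : ℤ
  r = + (q ∸ 1)

  δ-invariant : Invariant 2 δ
  δ-invariant v≉0 u = δ-cong-⇔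
    (λ v²u≈0 → xy≈0 v²u≈0 (^-nonzero 2 v≉0))
    (λ u≈0 → trans (*-congˡ u≈0) (zeroʳ _))

  W-reduce : ∀ {z n} (a : Vector Carrier n) m → (∀ j → 0 < m j) → Separated (λ j → gcd (m j) (q ∸ 1)) →
             W z a m δ ≡ W z a (λ j → gcd (gcd (m j) (q ∸ 1)) 2) δ
  W-reduce a m 0<m sep = ≡.trans (W-reduce-q∸1 a m δ-cong 0<m)
    (W-reduce-2 a (λ j → gcd (m j) (q ∸ 1)) δ-cong (λ j → 0<gcd (0<m j)) δ-invariant sep)

  -- The weights z = 1 and z = 0 give y = 0 and y = -1. The factor 0^t shows that in the count over
  -- all tuples only t = 0 leaves a correction to q^n.
  q*#solutions : ∀ {h} → Congruent h → h 0# ≡ 0ℤ → ∀ Q {n} (a : Vector Carrier n) m → (∀ j → 0 < m j) →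
                 Separated (λ j → gcd (m j) (q ∸ 1)) →
                 ∀ t → t ≤ n → ∀ (f : Vector ℤ n) → let s = λ j → if toℕ j <ᵇ t then 0ℤ else f j; zs = drop t (tabulate f) in
                 (∀ j → Eigen h Q (a j) (gcd (gcd (m j) (q ∸ 1)) 2) (s j)) →
                 (+ q) ℤ.* (W 1ℤ a m δ ℤ.- W 0ℤ a m δ) ≡
                 ((+ q) ℤ.^ n ℤ.+ r ℤ.* (0ℤ ℤ.^ t ℤ.* even 0ℤ Q zs)) ℤ.- (r ℤ.^ n ℤ.+ r ℤ.* (-1ℤ ℤ.^ t ℤ.* even -1ℤ Q zs))
  q*#solutions {h} h-cong h-0 Q {n} a m 0<m sep t t≤n f eigen = begin
    (+ q) ℤ.* (W 1ℤ a m δ ℤ.- W 0ℤ a m δ)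
      ≡⟨ x[y-z]≈xy-xz (+ q) (W 1ℤ a m δ) (W 0ℤ a m δ) ⟩
    (+ q) ℤ.* W 1ℤ a m δ ℤ.- (+ q) ℤ.* W 0ℤ a m δ
      ≡⟨ cong₂ ℤ._-_ (evaluate 1ℤ) (evaluate 0ℤ) ⟩
    (((+ q) ℤ.+ 0ℤ) ℤ.^ n ℤ.+ q∸1 ℤ.* even 0ℤ Q (tabulate s)) ℤ.- (q∸1 ℤ.^ n ℤ.+ q∸1 ℤ.* even -1ℤ Q (tabulate s))
      ≡⟨ cong (λ r → (((+ q) ℤ.+ 0ℤ) ℤ.^ n ℤ.+ r ℤ.* even 0ℤ Q (tabulate s)) ℤ.- (r ℤ.^ n ℤ.+ r ℤ.* even -1ℤ Q (tabulate s))) q∸1-+ ⟩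
    (((+ q) ℤ.+ 0ℤ) ℤ.^ n ℤ.+ r ℤ.* even 0ℤ Q (tabulate s)) ℤ.- (r ℤ.^ n ℤ.+ r ℤ.* even -1ℤ Q (tabulate s))
      ≡⟨ cong₂ (λ x y → ((x ℤ.^ n) ℤ.+ r ℤ.* y) ℤ.- (r ℤ.^ n ℤ.+ r ℤ.* even -1ℤ Q (tabulate s))) (ℤ.+-identityʳ (+ q)) (shifted-even 0ℤ Q f t t≤n) ⟩
    ((+ q) ℤ.^ n ℤ.+ r ℤ.* (0ℤ ℤ.^ t ℤ.* even 0ℤ Q zs)) ℤ.- (r ℤ.^ n ℤ.+ r ℤ.* even -1ℤ Q (tabulate s))
      ≡⟨ cong (λ x → ((+ q) ℤ.^ n ℤ.+ r ℤ.* (0ℤ ℤ.^ t ℤ.* even 0ℤ Q zs)) ℤ.- (r ℤ.^ n ℤ.+ r ℤ.* x)) (shifted-even -1ℤ Q f t t≤n) ⟩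
    ((+ q) ℤ.^ n ℤ.+ r ℤ.* (0ℤ ℤ.^ t ℤ.* even 0ℤ Q zs)) ℤ.- (r ℤ.^ n ℤ.+ r ℤ.* (-1ℤ ℤ.^ t ℤ.* even -1ℤ Q zs)) ∎
    where
    open ≡.≡-Reasoning
    open RingProperties ℤ.+-*-ring using (x[y-z]≈xy-xz)
    s : Vector ℤ n
    s j = if toℕ j <ᵇ t then 0ℤ else f j
    zs = drop t (tabulate f)
    evaluate : ∀ z → (+ q) ℤ.* W z a m δ ≡ ((+ q) ℤ.+ (z ℤ.- 1ℤ)) ℤ.^ n ℤ.+ q∸1 ℤ.* even (z ℤ.- 1ℤ) Q (tabulate s)
    evaluate z = ≡.trans (cong ((+ q) ℤ.*_) (W-reduce a m 0<m sep))
      (q*W-δ h-cong h-0 Q z a _ s (λ j → 0<gcd (0<gcd (0<m j))) eigen)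

  eigens : ∀ {h Q n} (a : Vector Carrier n) (d : Vector ℕ n) t (f : Vector ℤ n) →
           (∀ j → toℕ j < t → 2 ∤ d j) → (∀ j → t ≤ toℕ j → 2 ∣ d j) →
           (∀ j → Eigen h Q (a j) 1 0ℤ) → (∀ j → t ≤ toℕ j → Eigen h Q (a j) 2 (f j)) →
           ∀ j → Eigen h Q (a j) (gcd (d j) 2) (if toℕ j <ᵇ t then 0ℤ else f j)
  eigens {h} {Q} a d t f odd-d even-d linear quadratic j with <ᵇ-cases (toℕ j) t
  ... | inj₁ (j<t , eq) = ≡.subst₂ (λ e b → Eigen h Q (a j) e (if b then 0ℤ else f j)) (≡.sym (2∤⇒gcd≡1 (odd-d j j<t))) (≡.sym eq) (linear j)
  ... | inj₂ (t≤j , eq) = ≡.subst₂ (λ e b → Eigen h Q (a j) e (if b then 0ℤ else f j)) (≡.sym (2∣⇒gcd≡2 (even-d j t≤j))) (≡.sym eq) (quadratic j t≤j)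

  -- The equation exhibits Z as q times the integer P - X - Y, so the division in the conclusion is
  -- exact.
  solve-for : ∀ X P Z Y → (+ q) ℤ.* X ≡ (+ q) ℤ.* P ℤ.- Z ℤ.- (+ q) ℤ.* Y →
              fromℤ X ≡ fromℤ P ℚ.- Z /q ℚ.- fromℤ Y
  solve-for X P Z Y qX≡ = begin
    fromℤ X                                    ≡⟨ cong fromℤ (lem X P Y) ⟩
    fromℤ (P ℤ.- (P ℤ.- X ℤ.- Y) ℤ.- Y)        ≡⟨ fromℤ-- (P ℤ.- (P ℤ.- X ℤ.- Y)) Y ⟩
    fromℤ (P ℤ.- (P ℤ.- X ℤ.- Y)) ℚ.- fromℤ Y  ≡⟨ cong (ℚ._- fromℤ Y) (fromℤ-- P (P ℤ.- X ℤ.- Y)) ⟩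
    fromℤ P ℚ.- fromℤ (P ℤ.- X ℤ.- Y) ℚ.- fromℤ Y ≡⟨ cong (λ x → fromℤ P ℚ.- x ℚ.- fromℤ Y) (n*z/n≡z q {{q-nonZero}} (P ℤ.- X ℤ.- Y)) ⟨
    fromℤ P ℚ.- (((+ q) ℤ.* (P ℤ.- X ℤ.- Y)) /q) ℚ.- fromℤ Y ≡⟨ cong (λ x → fromℤ P ℚ.- x /q ℚ.- fromℤ Y) Z≡ ⟨
    fromℤ P ℚ.- Z /q ℚ.- fromℤ Y               ∎
    where
    open ≡.≡-Reasoning
    lem : ∀ X P Y → X ≡ P ℤ.- (P ℤ.- X ℤ.- Y) ℤ.- Y
    lem = solve-∀
    lem′ : ∀ q P Z Y → Z ≡ q ℤ.* P ℤ.- (q ℤ.* P ℤ.- Z ℤ.- q ℤ.* Y) ℤ.- q ℤ.* Y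
    lem′ = solve-∀
    lem″ : ∀ q X P Y → q ℤ.* P ℤ.- q ℤ.* X ℤ.- q ℤ.* Y ≡ q ℤ.* (P ℤ.- X ℤ.- Y)
    lem″ = solve-∀
    Z≡ : Z ≡ (+ q) ℤ.* (P ℤ.- X ℤ.- Y)
    Z≡ = ≡.trans (lem′ (+ q) P Z Y) (≡.trans (cong (λ x → (+ q) ℤ.* P ℤ.- x ℤ.- (+ q) ℤ.* Y) (≡.sym qX≡)) (lem″ (+ q) X P Y))

  summand : List ℤ → ℕ → ℤ
  summand zs j = η ((- 1#) ^ j) ℤ.* σ (2 ℕ.* j) zs ℤ.* (+ q) ℤ.^ (j ∸ 1)

  S : ℕ → List ℤ → ℤ
  S M zs = ∑₁ M (summand zs)

  module _ (1+1≉0 : 1# + 1# ≉ 0#) where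
    open QuadraticCharacter F 1+1≉0

    -- The square of the quadratic Gauss sum; it enters through `∑E-a*square`.
    Q : ℤ
    Q = η (- 1#) ℤ.* (+ q)

    Q^j : ∀ j → Q ℤ.^ j ≡ η ((- 1#) ^ j) ℤ.* (+ q) ℤ.^ j
    Q^j zero    = ≡.sym (≡.trans (ℤ.*-identityʳ _) η-1)
    Q^j (suc j) = ≡.trans (cong (Q ℤ.*_) (Q^j j)) (≡.trans (lem (η (- 1#)) (+ q) _ _) (cong (ℤ._* ((+ q) ℤ.* (+ q) ℤ.^ j)) (≡.sym (η-* (- 1#) ((- 1#) ^ j)))))
      where
      lem : ∀ p q x y → p ℤ.* q ℤ.* (x ℤ.* y) ≡ p ℤ.* x ℤ.* (q ℤ.* y)
      lem = solve-∀

    -- The term j = 0 is 1, and every later one contains a factor q from Q^j. Extracting it leaves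
    -- the exponent j - 1.
    σ-even-S : ∀ K zs → σ-even Q (suc K) zs ≡ 1ℤ ℤ.+ (+ q) ℤ.* S K zs
    σ-even-S K zs = cong (λ x → 1ℤ ℤ.+ x) (≡.trans (Σ<-cong K term)
      (≡.trans (Σ<-*ˡ K (+ q) (summand zs ∘ suc)) (cong ((+ q) ℤ.*_) (≡.sym (∑₁≡Σ< K (summand zs))))))
      where
      lem : ∀ s e q x → s ℤ.* (e ℤ.* (q ℤ.* x)) ≡ q ℤ.* (e ℤ.* s ℤ.* x)
      lem = solve-∀
      term : ∀ j → σ (2 ℕ.* suc j) zs ℤ.* Q ℤ.^ suc j ≡ (+ q) ℤ.* summand zs (suc j)
      term j = ≡.trans (cong (σ (2 ℕ.* suc j) zs ℤ.*_) (Q^j (suc j))) (lem (σ (2 ℕ.* suc j) zs) (η ((- 1#) ^ suc j)) (+ q) ((+ q) ℤ.^ j))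

    eigen-quadratic : ∀ {a} → a ≉ 0# → Eigen η Q a 2 (η a)
    eigen-quadratic a≉0 u = ∑E-a*square a≉0 u , ∑η-a*square a≉0 u

    q*#solutions-η : ∀ {n} (a : Vector Carrier n) → (∀ j → a j ≉ 0#) → ∀ m → (∀ j → 0 < m j) →
                     Separated (λ j → gcd (m j) (q ∸ 1)) → ∀ t → t ≤ n →
                     (∀ j → toℕ j < t → 2 ∤ gcd (m j) (q ∸ 1)) → (∀ j → t ≤ toℕ j → 2 ∣ gcd (m j) (q ∸ 1)) →
                     let zs = drop t (tabulate (λ j → η (a j))) in
                     (+ q) ℤ.* (W 1ℤ a m δ ℤ.- W 0ℤ a m δ) ≡
                     ((+ q) ℤ.^ n ℤ.+ r ℤ.* (0ℤ ℤ.^ t ℤ.* even 0ℤ Q zs)) ℤ.- (r ℤ.^ n ℤ.+ r ℤ.* (-1ℤ ℤ.^ t ℤ.* even -1ℤ Q zs))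
    q*#solutions-η a a≉0 m 0<m sep t t≤n odd-d even-d =
      q*#solutions η-cong (η-0 refl) Q a m 0<m sep t t≤n (λ j → η (a j))
        (eigens {h = η} {Q} a (λ j → gcd (m j) (q ∸ 1)) t (λ j → η (a j)) odd-d even-d (λ j → eigen-linear η-cong ∑η≡0 Q (a≉0 j)) (λ j _ → eigen-quadratic (a≉0 j)))

  q*#solutions-linear : ∀ {n} (a : Vector Carrier (suc n)) → (∀ j → a j ≉ 0#) → ∀ m → (∀ j → 0 < m j) →
    Separated (λ j → gcd (m j) (q ∸ 1)) →
    (∀ j → toℕ j < suc n → 2 ∤ gcd (m j) (q ∸ 1)) → (∀ j → suc n ≤ toℕ j → 2 ∣ gcd (m j) (q ∸ 1)) →
    (+ q) ℤ.* (W 1ℤ a m δ ℤ.- W 0ℤ a m δ) ≡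
    (+ q) ℤ.* (+ q) ℤ.^ n ℤ.- (r ℤ.^ suc n ℤ.+ -1ℤ ℤ.^ suc n ℤ.* r) ℤ.- (+ q) ℤ.* 0ℤ
  q*#solutions-linear {n} a a≉0 m 0<m sep odd-d even-d = ≡.trans
    (q*#solutions {h = λ _ → 0ℤ} (λ _ → ≡.refl) ≡.refl 0ℤ a m 0<m sep (suc n) ℕ.≤-refl (λ _ → 0ℤ)
      (eigens {h = λ _ → 0ℤ} {0ℤ} a (λ j → gcd (m j) (q ∸ 1)) (suc n) (λ _ → 0ℤ) odd-d even-d
        (λ j → eigen-linear {h = λ _ → 0ℤ} (λ _ → ≡.refl) (∑-const 0ℤ) 0ℤ (a≉0 j))
        (λ j n≤j → contradiction (Fin.toℕ<n j) (ℕ.≤⇒≯ n≤j))))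
    (≡.trans (cong (λ zs → ((+ q) ℤ.^ suc n ℤ.+ r ℤ.* (0ℤ ℤ.^ suc n ℤ.* even 0ℤ 0ℤ zs)) ℤ.- (r ℤ.^ suc n ℤ.+ r ℤ.* (-1ℤ ℤ.^ suc n ℤ.* even -1ℤ 0ℤ zs)))
        (List.drop-all (suc n) (tabulate {n = suc n} (λ _ → 0ℤ)) (ℕ.≤-reflexive (List.length-tabulate {n = suc n} (λ _ → 0ℤ)))))
      (lem (+ q) ((+ q) ℤ.^ n) r (r ℤ.^ suc n) (-1ℤ ℤ.^ suc n) (0ℤ ℤ.^ n)))
    where
    lem : ∀ q p r x s o → (q ℤ.* p ℤ.+ r ℤ.* (0ℤ ℤ.* o ℤ.* 1ℤ)) ℤ.- (x ℤ.+ r ℤ.* (s ℤ.* 1ℤ)) ≡ q ℤ.* p ℤ.- (x ℤ.+ s ℤ.* r) ℤ.- q ℤ.* 0ℤ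
    lem = solve-∀

theorem1 :
    ∀ {c ℓ} {q : ℕ} (F : FiniteField c ℓ q) →
    let open FiniteField F in
    (n : ℕ) → 2 ≤ n →
    (a : Vector Carrier n) → (∀ j → a j ≉ 0#) →
    (b : Carrier) → b ≉ 0# →
    (k : ℕ) → 0 < k →
    (ks : Vector ℕ n) → (∀ j → 0 < ks j) →
    (m : Vector ℕ n) → (∀ j → 0 < m j) →
    let
      N : ℕ
      N = count {n = n} (λ x → sum (λ j → a j * x j ^ m j) ^ k ≟ b * product (λ j → x j ^ ks j))

      d : Fin n → ℕ
      d j = gcd (m j) (q ∸ 1)

      k₀ : ℕ
      k₀ = gcd k (Vector.foldr gcd (q ∸ 1) ks)
    in
    (t : ℕ) → t ≤ n →
    (∀ j → toℕ j < t → 2 ∤ d j) →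
    (∀ j → t ≤ toℕ j → 2 ∣ d j) →
    let
      d′ : Fin n → ℕ
      d′ j = if toℕ j <ᵇ t then d j else d j / 2
    in
    (∀ i j → i ≢ j → Coprime (d′ i) (d′ j)) →
    ¬ IsPower k₀ b →
    let
      q-1 : ℤ
      q-1 = + (q ∸ 1)

      ηs : List ℤ
      ηs = tabulate (λ j → η (a j))

      S : ℕ → List ℤ → ℤ
      S M zs = ∑₁ M (λ j → η ((- 1#) ^ j) ℤ.* σ (2 ℕ.* j) zs ℤ.* (+ q) ℤ.^ (j ∸ 1))
    in
    (t ≡ 0 → 2 ∣ n →
      fromℤ (+ N) ≡ fromℤ ((+ q) ℤ.^ (n ∸ 1))
                    ℚ.- (q-1 ℤ.^ n ℤ.+ q-1) /q
                    ℚ.- fromℤ (q-1 ℤ.* S ((n ∸ 2) / 2) ηs))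
    ×
    (t ≡ n →
      fromℤ (+ N) ≡ fromℤ ((+ q) ℤ.^ (n ∸ 1))
                    ℚ.- (q-1 ℤ.^ n ℤ.+ -1ℤ ℤ.^ n ℤ.* q-1) /q)
    ×
    (¬ (t ≡ 0 × 2 ∣ n) → t ≢ n →
      fromℤ (+ N) ≡ fromℤ ((+ q) ℤ.^ (n ∸ 1))
                    ℚ.- (q-1 ℤ.^ n ℤ.+ -1ℤ ℤ.^ n ℤ.* q-1) /q
                    ℚ.- fromℤ (-1ℤ ℤ.^ n ℤ.* q-1 ℤ.* S ((n ∸ t) / 2) (drop t ηs)))
theorem1 {q = q} F (suc (suc n)) (s≤s (s≤s z≤n)) a a≉0 b b≉0 k 0<k ks 0<ks m 0<m t t≤n odd-d even-d coprime ¬power =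
  all-even , all-odd , mixed
  where
  open FiniteField F hiding (zero)
  open DiagonalSums F
  open Delta F
  open Counting F
  open SolutionCount F
  open ≡.≡-Reasoning
  N : ℕ
  N = count {n = suc (suc n)} (λ x → sum (λ j → a j * x j ^ m j) ^ k ≟ b * product (λ j → x j ^ ks j))
  d d′ : Fin (suc (suc n)) → ℕ
  d j = gcd (m j) (q ∸ 1)
  d′ j = if toℕ j <ᵇ t then d j else d j / 2
  X : ℤ
  X = W 1ℤ a m δ ℤ.- W 0ℤ a m δ
  ηs : List ℤ
  ηs = tabulate (λ j → η (a j))

  N≡X : + N ≡ X
  N≡X = solutions a b≉0 0<k ks 0<ks m (0<gcd 0<k) (gcd[m,n]∣m k _)
    (λ j → ∣-trans (gcd[m,n]∣n k _) (foldr-gcd-∣ ks (q ∸ 1) j)) ¬power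

  d∣2d′ : ∀ j → d j ∣ d′ j ℕ.* 2
  d∣2d′ j with <ᵇ-cases (toℕ j) t
  ... | inj₁ (_ , eq)   = ≡.subst (λ b → d j ∣ (if b then d j else d j / 2) ℕ.* 2) (≡.sym eq) (m∣m*n 2)
  ... | inj₂ (t≤j , eq) = ≡.subst (λ b → d j ∣ (if b then d j else d j / 2) ℕ.* 2) (≡.sym eq) (∣-reflexive (≡.sym (m/n*n≡m (even-d j t≤j))))

  sep : Separated d
  sep = separated d d′ d∣2d′ coprime

  -- For t < n the number dⱼ at position j = t is even and divides q - 1, so q is odd.
  1+1≉0 : t < suc (suc n) → 1# + 1# ≉ 0#
  1+1≉0 t<n = odd⇒1+1≉0 (∣-trans (even-d (Fin.fromℕ< t<n) (ℕ.≤-reflexive (≡.sym (Fin.toℕ-fromℕ< t<n)))) (gcd[m,n]∣n (m _) (q ∸ 1)))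

  all-even : t ≡ 0 → 2 ∣ suc (suc n) →
    fromℤ (+ N) ≡ fromℤ ((+ q) ℤ.^ suc n) ℚ.- (r ℤ.^ suc (suc n) ℤ.+ r) /q ℚ.- fromℤ (r ℤ.* S (n / 2) ηs)
  all-even ≡.refl 2∣n+2 = ≡.trans (cong fromℤ N≡X) (solve-for X ((+ q) ℤ.^ suc n) _ _ (begin
    (+ q) ℤ.* X
      ≡⟨ q*#solutions-η 2≉0 a a≉0 m 0<m sep 0 t≤n odd-d even-d ⟩
    ((+ q) ℤ.* P ℤ.+ r ℤ.* (1ℤ ℤ.* even 0ℤ Q′ ηs)) ℤ.- (r ℤ.^ suc (suc n) ℤ.+ r ℤ.* (1ℤ ℤ.* even -1ℤ Q′ ηs))
      ≡⟨ cong₂ (λ x y → ((+ q) ℤ.* P ℤ.+ r ℤ.* (1ℤ ℤ.* x)) ℤ.- (r ℤ.^ suc (suc n) ℤ.+ r ℤ.* (1ℤ ℤ.* y)))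
           (even-zero-even Q′ (suc K) ηs length-ηs)
           (≡.trans (proj₁ (even-odd-minus-one Q′ (suc (suc K)) ηs (≡.subst₂ _<_ (≡.sym length-ηs) (≡.sym (ℕ.*-suc 2 (suc K))) (ℕ.m<n⇒m<1+n ℕ.≤-refl))))
             (cong₂ ℤ._*_ sign≡1 (≡.trans (Σ<-last (suc K) (λ j → σ (2 ℕ.* j) ηs ℤ.* Q′ ℤ.^ j)) (cong (ℤ._+ T′) (σ-even-S 2≉0 K ηs))))) ⟩
    ((+ q) ℤ.* P ℤ.+ r ℤ.* (1ℤ ℤ.* T′)) ℤ.- (r ℤ.^ suc (suc n) ℤ.+ r ℤ.* (1ℤ ℤ.* (1ℤ ℤ.* (1ℤ ℤ.+ (+ q) ℤ.* S K ηs ℤ.+ T′))))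
      ≡⟨ lem (+ q) P r T′ (r ℤ.^ suc (suc n)) (S K ηs) ⟩
    (+ q) ℤ.* P ℤ.- (r ℤ.^ suc (suc n) ℤ.+ r) ℤ.- (+ q) ℤ.* (r ℤ.* S K ηs) ∎))
    where
    2≉0 = 1+1≉0 (s≤s z≤n)
    Q′ = Q 2≉0
    P = (+ q) ℤ.^ suc n
    K = n / 2
    -- The term of full degree. It is the whole correction in the count over all tuples and the last
    -- term in the count without zero coordinates, so it cancels; therefore the sum in the formula
    -- stops one step early, at (n - 2) / 2 for n coordinates.
    T′ = σ (2 ℕ.* suc K) ηs ℤ.* Q′ ℤ.^ suc K
    n+2≡ : suc (suc n) ≡ 2 ℕ.* suc K
    n+2≡ = ≡.trans (cong (λ x → suc (suc x)) (≡.trans (≡.sym (m/n*n≡m (∣m+n∣m⇒∣n 2∣n+2 ∣-refl))) (ℕ.*-comm K 2))) (≡.sym (ℕ.*-suc 2 K))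
    length-ηs : length ηs ≡ 2 ℕ.* suc K
    length-ηs = ≡.trans (List.length-tabulate (λ j → η (a j))) n+2≡
    sign≡1 : -1ℤ ℤ.^ length ηs ≡ 1ℤ
    sign≡1 = ≡.trans (cong (-1ℤ ℤ.^_) length-ηs) (≡.trans (≡.sym (ℤ.^-*-assoc -1ℤ 2 (suc K))) (ℤ.^-zeroˡ (suc K)))
    lem : ∀ q P r T x S → (q ℤ.* P ℤ.+ r ℤ.* (1ℤ ℤ.* T)) ℤ.- (x ℤ.+ r ℤ.* (1ℤ ℤ.* (1ℤ ℤ.* (1ℤ ℤ.+ q ℤ.* S ℤ.+ T)))) ≡
                          q ℤ.* P ℤ.- (x ℤ.+ r) ℤ.- q ℤ.* (r ℤ.* S)
    lem = solve-∀

  all-odd : t ≡ suc (suc n) →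
    fromℤ (+ N) ≡ fromℤ ((+ q) ℤ.^ suc n) ℚ.- (r ℤ.^ suc (suc n) ℤ.+ -1ℤ ℤ.^ suc (suc n) ℤ.* r) /q
  all-odd ≡.refl = ≡.trans (cong fromℤ N≡X) (≡.trans
    (solve-for X ((+ q) ℤ.^ suc n) _ 0ℤ (q*#solutions-linear a a≉0 m 0<m sep odd-d even-d))
    (ℚ.+-identityʳ _))

  mixed : ¬ (t ≡ 0 × 2 ∣ suc (suc n)) → t ≢ suc (suc n) →
    fromℤ (+ N) ≡ fromℤ ((+ q) ℤ.^ suc n) ℚ.- (r ℤ.^ suc (suc n) ℤ.+ -1ℤ ℤ.^ suc (suc n) ℤ.* r) /q
                  ℚ.- fromℤ (-1ℤ ℤ.^ suc (suc n) ℤ.* r ℤ.* S ((suc (suc n) ∸ t) / 2) (drop t ηs))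
  mixed ¬all-even t≢n = ≡.trans (cong fromℤ N≡X) (solve-for X ((+ q) ℤ.^ suc n) _ _ (begin
    (+ q) ℤ.* X
      ≡⟨ q*#solutions-η 2≉0 a a≉0 m 0<m sep t t≤n odd-d even-d ⟩
    ((+ q) ℤ.* P ℤ.+ r ℤ.* (0ℤ ℤ.^ t ℤ.* even 0ℤ Q′ zs)) ℤ.- (r ℤ.^ suc (suc n) ℤ.+ r ℤ.* (-1ℤ ℤ.^ t ℤ.* even -1ℤ Q′ zs))
      ≡⟨ cong₂ (λ x y → ((+ q) ℤ.* P ℤ.+ r ℤ.* x) ℤ.- (r ℤ.^ suc (suc n) ℤ.+ r ℤ.* y)) (even-zero t ≡.refl) minus-one ⟩
    ((+ q) ℤ.* P ℤ.+ r ℤ.* 0ℤ) ℤ.- (r ℤ.^ suc (suc n) ℤ.+ r ℤ.* (s ℤ.* (1ℤ ℤ.+ (+ q) ℤ.* S K zs)))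
      ≡⟨ lem (+ q) P r s (r ℤ.^ suc (suc n)) (S K zs) ⟩
    (+ q) ℤ.* P ℤ.- (r ℤ.^ suc (suc n) ℤ.+ s ℤ.* r) ℤ.- (+ q) ℤ.* (s ℤ.* r ℤ.* S K zs) ∎))
    where
    2≉0 = 1+1≉0 (ℕ.≤∧≢⇒< t≤n t≢n)
    Q′ = Q 2≉0
    P = (+ q) ℤ.^ suc n
    s = -1ℤ ℤ.^ suc (suc n)
    K = (suc (suc n) ∸ t) / 2
    zs = drop t ηs
    length-zs : length zs ≡ suc (suc n) ∸ t
    length-zs = ≡.trans (List.length-drop t ηs) (cong (_∸ t) (List.length-tabulate (λ j → η (a j))))
    -- The count over all tuples has no correction here: if t > 0 because of the factor 0^t, and if
    -- t = 0 because the number of coordinates is then odd.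
    even-zero : ∀ t′ → t ≡ t′ → 0ℤ ℤ.^ t′ ℤ.* even 0ℤ Q′ zs ≡ 0ℤ
    even-zero zero    ≡.refl = ≡.trans (ℤ.*-identityˡ _) (even-zero-odd Q′ (suc (suc n) / 2) zs (≡.trans length-zs (odd⇒1+2*[m/2] (λ 2∣n → ¬all-even (≡.refl , 2∣n)))))
    even-zero (suc _) _      = ≡.refl
    minus-one : -1ℤ ℤ.^ t ℤ.* even -1ℤ Q′ zs ≡ s ℤ.* (1ℤ ℤ.+ (+ q) ℤ.* S K zs)
    minus-one = begin
      -1ℤ ℤ.^ t ℤ.* even -1ℤ Q′ zs
        ≡⟨ cong (-1ℤ ℤ.^ t ℤ.*_) (≡.trans (proj₁ (even-odd-minus-one Q′ (suc K) zs (≡.subst (_< 2 ℕ.* suc K) (≡.sym length-zs) (m<2*[1+m/2] _))))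
             (cong₂ ℤ._*_ (cong (-1ℤ ℤ.^_) length-zs) (σ-even-S 2≉0 K zs))) ⟩
      -1ℤ ℤ.^ t ℤ.* (-1ℤ ℤ.^ (suc (suc n) ∸ t) ℤ.* (1ℤ ℤ.+ (+ q) ℤ.* S K zs))
        ≡⟨ ℤ.*-assoc (-1ℤ ℤ.^ t) _ _ ⟨
      -1ℤ ℤ.^ t ℤ.* -1ℤ ℤ.^ (suc (suc n) ∸ t) ℤ.* (1ℤ ℤ.+ (+ q) ℤ.* S K zs)
        ≡⟨ cong (ℤ._* (1ℤ ℤ.+ (+ q) ℤ.* S K zs)) (≡.trans (≡.sym (ℤ.^-distribˡ-+-* -1ℤ t _)) (cong (-1ℤ ℤ.^_) (ℕ.m+[n∸m]≡n t≤n))) ⟩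
      s ℤ.* (1ℤ ℤ.+ (+ q) ℤ.* S K zs) ∎
    lem : ∀ q P r s x S → (q ℤ.* P ℤ.+ r ℤ.* 0ℤ) ℤ.- (x ℤ.+ r ℤ.* (s ℤ.* (1ℤ ℤ.+ q ℤ.* S))) ≡
                          q ℤ.* P ℤ.- (x ℤ.+ s ℤ.* r) ℤ.- q ℤ.* (s ℤ.* r ℤ.* S)
    lem = solve-∀
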